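{- Let $\alpha \geq 1$ be a real number and let $S$ be an infinite set of positive integers of polynomial density $\alpha$. Let $P(S)$ be the set of primes dividing at least one element of $S$, and let $\pi_S(n) = \operatorname{card}\{p \in P(S) : p \leq n\}$. Then: (a) $\displaystyle\sum_{p \in P(S)} p^{ -1/\alpha} = \infty$. (b) $\displaystyle\sum_{n=1}^\infty \frac{\pi_S(n)}{n^{1+1/\alpha}} = \infty$. (c) If $(a_n)_{n=1}^\infty$ is a sequence of real numbers with $a_n > 0$ for all $n$ and $\sum_{n=1}^\infty a_n < \infty$, then $\displaystyle\frac{\pi_S(n)}{n^{1+1/\alpha}} \geq a_n$ for infinitely many positive integers $n$.
   Context: For real $\alpha \geq 1$ (not necessarily an integer), an infinite set $S$ of positive integers is said to have polynomial density $\alpha$ if $S$ is the range of a strictly increasing sequence $(s_n)_{n=1}^\infty$ of positive integers such that $s_n = O(n^\alpha)$, i.e. there is a constant $C > 0$ with $s_n \leq C n^\alpha$ for all $n \geq 1$. (Only this upper bound is required.) The set of prime factors of elements of $S$ is $$P(S) = \{p : p \text{ is prime and } p \mid s \text{ for at least one } s \in S\}.$$ -}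

module Defs where

open import Algebra.Bundles using (CommutativeRing)
import Algebra.Properties.Monoid.Mult as Mult
import Algebra.Properties.Semiring.Exp as Exp
open import Algebra.Structures using (IsCommutativeRing)
open import Axiom.ExcludedMiddle using (ExcludedMiddle)
open import Data.List.Base using (List; filter; foldr; length; map; upTo)
open import Data.Nat.Base as ℕ using (ℕ; suc)
open import Data.Nat.Divisibility using (_∣_)
open import Data.Nat.Primality using (Prime)
open import Data.Product.Base using (_×_; ∃; proj₁)
open import Function.Bundles using (_⇔_)
open import Level using (0ℓ) renaming (suc to lsuc)
open import Relation.Binary.Core using (Rel)
open import Relation.Binary.Structures using (IsTotalOrder)
import Relation.Binary.Construct.NonStrictToStrict as ToStrict
open import Relation.Nullary using (¬_; yes; no)
open import Relation.Unary using (Pred)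
open import Relation.Binary.PropositionalEquality using (_≡_)

-- The real numbers enter through their usual axiomatisation, which determines
-- them up to unique isomorphism.
-- The inverse is total; only its values away from 0# are specified.
record CompleteOrderedField : Set (lsuc 0ℓ) where
  infix  4 _≈_ _≤_
  infixl 6 _+_
  infixl 7 _*_
  infix  8 -_
  infix  9 _⁻¹
  field
    Carrier           : Set
    _≈_ _≤_           : Rel Carrier 0ℓ
    _+_ _*_           : Carrier → Carrier → Carrier
    -_ _⁻¹            : Carrier → Carrier
    0# 1#             : Carrier
    isCommutativeRing : IsCommutativeRing _≈_ _+_ _*_ -_ 0# 1#
    1≉0               : ¬ 1# ≈ 0#
    ⁻¹-cong           : ∀ {x y} → x ≈ y → x ⁻¹ ≈ y ⁻¹
    ⁻¹-inverseʳ       : ∀ x → ¬ x ≈ 0# → x * x ⁻¹ ≈ 1#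
    isTotalOrder      : IsTotalOrder _≈_ _≤_
    +-monoʳ-≤         : ∀ x {y z} → y ≤ z → x + y ≤ x + z
    *-nonNegative     : ∀ {x y} → 0# ≤ x → 0# ≤ y → 0# ≤ x * y

  UpperBound : Pred Carrier 0ℓ → Pred Carrier 0ℓ
  UpperBound P u = ∀ x → P x → x ≤ u

  LeastUpperBound : Pred Carrier 0ℓ → Pred Carrier 0ℓ
  LeastUpperBound P u = UpperBound P u × (∀ v → UpperBound P v → u ≤ v)

  field
    complete : (P : Pred Carrier 0ℓ) → ∃ P → ∃ (UpperBound P) →
               ∃ (LeastUpperBound P)

  commutativeRing : CommutativeRing 0ℓ 0ℓ
  commutativeRing = record { isCommutativeRing = isCommutativeRing }

  open CommutativeRing commutativeRing public using (+-monoid; semiring)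
  open ToStrict _≈_ _≤_ public using (_<_)

  open Exp semiring public using (_^_)

  fromℕ : ℕ → Carrier
  fromℕ n = Mult._×_ +-monoid n 1#

Infinite : Pred ℕ 0ℓ → Set
Infinite P = ∀ m → ∃ λ n → m ℕ.≤ n × P n

-- The primes dividing at least one element of S.
PrimeFactor : Pred ℕ 0ℓ → Pred ℕ 0ℓ
PrimeFactor S p = Prime p × ∃ λ s → S s × p ∣ s

-- Excluded middle is the ambient classical logic: membership in an arbitrary
-- set of integers must be decided in order to count its elements.
module Classical (em : ExcludedMiddle 0ℓ) (R : CompleteOrderedField) where

  open CompleteOrderedField R

  -- Meaningful when P is inhabited and bounded above.
  sup : Pred Carrier 0ℓ → Carrier
  sup P with em {∃ P} | em {∃ (UpperBound P)}
  ... | yes inh | yes bdd = proj₁ (complete P inh bdd)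
  ... | _       | _       = 0#

  -- RationalPower b x z : z = b ^ r for some rational r = (i - j) / k ≤ x.
  RationalPower : Carrier → Carrier → Pred Carrier 0ℓ
  RationalPower b x z =
    0# < z ×
    ∃ λ i → ∃ λ j → ∃ λ k →
      0 ℕ.< k ×
      fromℕ i ≤ fromℕ k * x + fromℕ j ×
      z ^ k * b ^ j ≈ b ^ i

  -- The real power of a base b ≥ 1, as the supremum of the rational powers
  -- with exponent at most x; for smaller bases the value is not meaningful.
  infixr 8 _^ᴿ_
  _^ᴿ_ : Carrier → Carrier → Carrier
  b ^ᴿ x = sup (RationalPower b x)

  sumOver : List ℕ → (ℕ → Carrier) → Carrier
  sumOver ns f = foldr _+_ 0# (map f ns)

  -- f 1 + … + f n; the value f 0 is not used.
  partialSum : (ℕ → Carrier) → ℕ → Carrier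
  partialSum f n = sumOver (map suc (upTo n)) f

  Converges : (ℕ → Carrier) → Set
  Converges u = ∃ λ l → ∀ ε → 0# < ε → ∃ λ m → ∀ n → m ℕ.≤ n →
                u n ≤ l + ε × l ≤ u n + ε

  TendsTo∞ : (ℕ → Carrier) → Set
  TendsTo∞ u = ∀ c → ∃ λ m → ∀ n → m ℕ.≤ n → c ≤ u n

  -- S is the range of the sequence s 1 < s 2 < …; the value s 0 is not used.
  HasPolynomialDensity : Carrier → Pred ℕ 0ℓ → Set
  HasPolynomialDensity α S =
    ∃ λ (s : ℕ → ℕ) →
      (∀ n → 1 ℕ.≤ n → 0 ℕ.< s n) ×
      (∀ m n → 1 ℕ.≤ m → m ℕ.< n → s m ℕ.< s n) ×
      (∀ k → S k ⇔ (∃ λ n → 1 ℕ.≤ n × s n ≡ k)) ×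
      (∃ λ C → 0# < C ×
        (∀ n → 1 ℕ.≤ n → fromℕ (s n) ≤ C * fromℕ n ^ᴿ α))

  -- The elements of P(S) up to n, in increasing order.
  primeFactorsUpTo : Pred ℕ 0ℓ → ℕ → List ℕ
  primeFactorsUpTo S n = filter (λ p → em {PrimeFactor S p}) (upTo (suc n))

  π : Pred ℕ 0ℓ → ℕ → ℕ
  π S n = length (primeFactorsUpTo S n)

  -- π_S(n) / n^(1 + 1/α)
  ratio : Carrier → Pred ℕ 0ℓ → ℕ → Carrier
  ratio α S n = fromℕ (π S n) * (fromℕ n ^ᴿ (1# + α ⁻¹)) ⁻¹

-- Let h n = n ^ (-1/α). It is positive, submultiplicative and less than 1 at
-- every prime, and s n ≤ C n ^ α gives h (s n) ≥ 1 / (D n). If ∑ h p over P(S)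
-- converged, then so would ∑ h n over the integers all of whose prime factors
-- lie in P(S): when the sum of h over the primes p ≥ M of P(S) is at most 1/2,
-- extracting one prime factor shows that the sum T over the integers built from
-- these primes satisfies T ≤ 1 + T/2, and admitting one further prime p divides
-- such a sum by at most 1 - h p. Every element of S is such an integer, which
-- contradicts the divergence of the harmonic series.
-- For (b), interchange the order of summation in ∑ π_S(n) / n ^ (1 + 1/α): a
-- prime p collects the terms with p ≤ n < 2p, whose sum is at least h p / 16.
-- Part (c) follows from (b) by comparison.

module Submission where

open import Defs
open import Algebra.Bundles using (CommutativeRing)
import Algebra.Properties.CommutativeSemiring.Exp as Exp
import Algebra.Properties.Semiring.Mult as Mult
import Algebra.Solver.Ring.NaturalCoefficients.Default as Solver
open import Axiom.ExcludedMiddle using (ExcludedMiddle)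
open import Data.Bool.Base using (if_then_else_)
open import Data.List.Base using (List; []; _∷_; _++_; _∷ʳ_; filter; length; map; upTo)
open import Data.List.Properties using (filter-++; map-++; upTo-∷ʳ)
open import Data.List.Relation.Unary.All using (All; []; _∷_)
open import Data.Nat.Base as ℕ using (ℕ; zero; suc; z≤n; s≤s)
open import Data.Nat.Divisibility
  using (_∣_; divides; quotient; quotient-∣; m∣n⇒n≡m*quotient; ∣-trans; ∣⇒≤)
open import Data.Nat.ListAction using (product)
open import Data.Nat.Primality using (Prime; prime⇒nonTrivial)
open import Data.Nat.Primality.Factorisation using (PrimeFactorisation; factorise)
import Data.Nat.Properties as ℕ
open import Data.Product.Base using (_×_; _,_; ∃; proj₁; proj₂)
open import Data.Sum.Base using (_⊎_; inj₁; inj₂)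
open import Function.Base using (_∘_)
open import Function.Bundles using (Equivalence)
open import Level using (0ℓ)
open import Relation.Binary.Bundles using (Poset)
open import Relation.Binary.PropositionalEquality as ≡ using (_≡_)
import Relation.Binary.Reasoning.PartialOrder as ≤-Reasoning
open import Relation.Binary.Structures using (IsTotalOrder)
open import Relation.Nullary using (¬_; Dec; yes; no; does; contradiction)
open import Relation.Unary using (Pred)

-- The obstacle is that `_^ᴿ_` is a supremum of rational powers and comes without laws of exponents.
-- An estimate between real powers is therefore raised to a natural power, where `^ᴿ-upper` and
-- `^ᴿ-lower` replace real exponents by nearby integers, and a root is taken at the end. Rounding
-- leaves a stray power of the base n, but the natural power grows linearly with n, and n ^ (1/n) ≤
-- 2 turns the stray factor into a constant. Identities such as (n ^ α) ^ (-1/α) = 1/n are thus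
-- replaced by inequalities up to a constant, which is the origin of D and of 16. All sums of the
-- sieve are truncated at some `N`. This makes T ≤ 1 + T/2 an inequality between finite numbers,
-- solvable for T before any convergence is known. The truncation is compatible with extracting a
-- prime, because both factors of n = p m are at most n.

-- Arithmetic in an ordered field.

module OrderedField (em : ExcludedMiddle 0ℓ) (R : CompleteOrderedField) where

  open CompleteOrderedField R public
  open CommutativeRing commutativeRing public
    using ( commutativeSemiring; refl; sym; trans
          ; +-cong; +-congˡ; +-congʳ; +-assoc; +-comm; +-identityˡ; +-identityʳ
          ; -‿inverseˡ; -‿inverseʳ
          ; *-cong; *-congˡ; *-congʳ; *-assoc; *-comm; *-identityˡ; *-identityʳ
          ; distribˡ; distribʳ; zeroˡ; zeroʳ)
  open IsTotalOrder isTotalOrder public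
    using (isPartialOrder; total; antisym)
    renaming (refl to ≤-refl; trans to ≤-trans; reflexive to ≤-reflexive)
  open Exp commutativeSemiring public
    using (^-congˡ; ^-homo-*; ^-assocʳ; ^-distrib-*)
  open Solver commutativeSemiring public
    using (solve; _:=_; _:+_; _:*_; _:^_; con)

  poset : Poset 0ℓ 0ℓ 0ℓ
  poset = record { isPartialOrder = isPartialOrder }

  open ≤-Reasoning poset public

  <⇒≤ : ∀ {x y} → x < y → x ≤ y
  <⇒≤ = proj₁

  <⇒≱ : ∀ {x y} → x < y → ¬ y ≤ x
  <⇒≱ (x≤y , x≉y) y≤x = x≉y (antisym x≤y y≤x)

  ≰⇒> : ∀ {x y} → ¬ x ≤ y → y < x
  ≰⇒> {x} {y} x≰y with total x y
  ... | inj₁ x≤y = contradiction x≤y x≰y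
  ... | inj₂ y≤x = y≤x , λ y≈x → x≰y (≤-reflexive (sym y≈x))

  ≮⇒≥ : ∀ {x y} → ¬ x < y → y ≤ x
  ≮⇒≥ {x} {y} x≮y with em {y ≤ x}
  ... | yes y≤x = y≤x
  ... | no  y≰x = contradiction (≰⇒> y≰x) x≮y

  +-mono-≤ : ∀ {x y u v} → x ≤ y → u ≤ v → x + u ≤ y + v
  +-mono-≤ {x} {y} {u} {v} x≤y u≤v = begin
    x + u ≤⟨ +-monoʳ-≤ x u≤v ⟩
    x + v ≈⟨ +-comm x v ⟩
    v + x ≤⟨ +-monoʳ-≤ v x≤y ⟩
    v + y ≈⟨ +-comm v y ⟩
    y + v ∎

  +-nonNegative : ∀ {x y} → 0# ≤ x → 0# ≤ y → 0# ≤ x + y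
  +-nonNegative {x} {y} 0≤x 0≤y = begin
    0#      ≈⟨ +-identityˡ 0# ⟨
    0# + 0# ≤⟨ +-mono-≤ 0≤x 0≤y ⟩
    x + y   ∎

  x+[y-x]≈y : ∀ x y → x + (y + - x) ≈ y
  x+[y-x]≈y x y = begin-equality
    x + (y + - x) ≈⟨ solve 3 (λ a b c → a :+ (b :+ c) := (a :+ c) :+ b) refl x y (- x) ⟩
    (x + - x) + y ≈⟨ +-congʳ (-‿inverseʳ x) ⟩
    0# + y        ≈⟨ +-identityˡ y ⟩
    y             ∎

  x*-y+x*y≈0 : ∀ x y → x * - y + x * y ≈ 0#
  x*-y+x*y≈0 x y = begin-equality
    x * - y + x * y ≈⟨ distribˡ x (- y) y ⟨
    x * (- y + y)   ≈⟨ *-congˡ (-‿inverseˡ y) ⟩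
    x * 0#          ≈⟨ zeroʳ x ⟩
    0#              ∎

  +-cancelˡ-≤ : ∀ z {x y} → z + x ≤ z + y → x ≤ y
  +-cancelˡ-≤ z {x} {y} z+x≤z+y = begin
    x             ≈⟨ cancel x ⟨
    - z + (z + x) ≤⟨ +-monoʳ-≤ (- z) z+x≤z+y ⟩
    - z + (z + y) ≈⟨ cancel y ⟩
    y             ∎
    where
    cancel : ∀ w → - z + (z + w) ≈ w
    cancel w = begin-equality
      - z + (z + w) ≈⟨ +-assoc (- z) z w ⟨
      - z + z + w   ≈⟨ +-congʳ (-‿inverseˡ z) ⟩
      0# + w        ≈⟨ +-identityˡ w ⟩
      w             ∎

  +-cancelʳ-≤ : ∀ z {x y} → x + z ≤ y + z → x ≤ y
  +-cancelʳ-≤ z {x} {y} x+z≤y+z = +-cancelˡ-≤ z (begin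
    z + x ≈⟨ +-comm z x ⟩
    x + z ≤⟨ x+z≤y+z ⟩
    y + z ≈⟨ +-comm y z ⟩
    z + y ∎)

  ≤⇒∃+ : ∀ {x y} → x ≤ y → ∃ λ d → 0# ≤ d × y ≈ x + d
  ≤⇒∃+ {x} {y} x≤y = y + - x , +-cancelˡ-≤ x
    (begin
      x + 0#        ≈⟨ +-identityʳ x ⟩
      x             ≤⟨ x≤y ⟩
      y             ≈⟨ x+[y-x]≈y x y ⟨
      x + (y + - x) ∎)
    , sym (x+[y-x]≈y x y)

  <⇒∃+ : ∀ {x y} → x < y → ∃ λ d → 0# < d × y ≈ x + d
  <⇒∃+ {x} {y} (x≤y , x≉y) = let d , 0≤d , y≈x+d = ≤⇒∃+ x≤y in
    d , (0≤d , λ 0≈d → x≉y (begin-equality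
    x      ≈⟨ +-identityʳ x ⟨
    x + 0# ≈⟨ +-congˡ 0≈d ⟩
    x + d  ≈⟨ y≈x+d ⟨
    y      ∎)) , y≈x+d

  x≤x+y : ∀ x {y} → 0# ≤ y → x ≤ x + y
  x≤x+y x {y} 0≤y = begin
    x      ≈⟨ +-identityʳ x ⟨
    x + 0# ≤⟨ +-monoʳ-≤ x 0≤y ⟩
    x + y  ∎

  y≤x+y : ∀ {x} y → 0# ≤ x → y ≤ x + y
  y≤x+y {x} y 0≤x = ≤-trans (x≤x+y y 0≤x) (≤-reflexive (+-comm y x))

  x<x+y : ∀ x {y} → 0# < y → x < x + y
  x<x+y x {y} 0<y = ≰⇒> λ x+y≤x → <⇒≱ 0<y (+-cancelˡ-≤ x
    (≤-trans x+y≤x (≤-reflexive (sym (+-identityʳ x)))))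

  0≤1 : 0# ≤ 1#
  0≤1 with total 0# 1#
  ... | inj₁ p   = p
  ... | inj₂ 1≤0 = begin
    0#                             ≤⟨ *-nonNegative 0≤-1 0≤-1 ⟩
    - 1# * - 1#                    ≈⟨ y≈ ⟩
    1#                             ∎
    where
    0≤-1 : 0# ≤ - 1#
    0≤-1 = begin
      0#        ≈⟨ -‿inverseˡ 1# ⟨
      - 1# + 1# ≤⟨ +-monoʳ-≤ (- 1#) 1≤0 ⟩
      - 1# + 0# ≈⟨ +-identityʳ (- 1#) ⟩
      - 1#      ∎
    y≈ : - 1# * - 1# ≈ 1#
    y≈ = begin-equality
      - 1# * - 1#                     ≈⟨ +-identityˡ _ ⟨
      0# + - 1# * - 1#                ≈⟨ +-congʳ (-‿inverseʳ 1#) ⟨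
      1# + - 1# + - 1# * - 1#         ≈⟨ solve 1 (λ a → con 1 :+ a :+ a :* a := con 1 :+ a :* (con 1 :+ a)) refl (- 1#) ⟩
      1# + - 1# * (1# + - 1#)         ≈⟨ +-congˡ (*-congˡ (-‿inverseʳ 1#)) ⟩
      1# + - 1# * 0#                  ≈⟨ +-congˡ (zeroʳ _) ⟩
      1# + 0#                         ≈⟨ +-identityʳ 1# ⟩
      1#                              ∎

  0<1 : 0# < 1#
  0<1 = 0≤1 , λ 0≈1 → 1≉0 (sym 0≈1)

  *-monoˡ-≤ : ∀ {z x y} → 0# ≤ z → x ≤ y → z * x ≤ z * y
  *-monoˡ-≤ {z} {x} {y} 0≤z x≤y = let d , 0≤d , y≈x+d = ≤⇒∃+ x≤y in begin
    z * x         ≤⟨ x≤x+y (z * x) (*-nonNegative 0≤z 0≤d) ⟩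
    z * x + z * d ≈⟨ distribˡ z x d ⟨
    z * (x + d)   ≈⟨ *-congˡ y≈x+d ⟨
    z * y         ∎

  *-monoʳ-≤ : ∀ {z x y} → 0# ≤ z → x ≤ y → x * z ≤ y * z
  *-monoʳ-≤ {z} {x} {y} 0≤z x≤y = begin
    x * z ≈⟨ *-comm x z ⟩
    z * x ≤⟨ *-monoˡ-≤ 0≤z x≤y ⟩
    z * y ≈⟨ *-comm z y ⟩
    y * z ∎

  *-mono-≤ : ∀ {x y u v} → 0# ≤ x → 0# ≤ v → x ≤ y → u ≤ v → x * u ≤ y * v
  *-mono-≤ 0≤x 0≤v x≤y u≤v = ≤-trans (*-monoˡ-≤ 0≤x u≤v) (*-monoʳ-≤ 0≤v x≤y)

  *-positive : ∀ {x y} → 0# < x → 0# < y → 0# < x * y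
  *-positive {x} {y} 0<x 0<y = *-nonNegative (<⇒≤ 0<x) (<⇒≤ 0<y) , λ 0≈xy →
    proj₂ 0<x (begin-equality
      0#           ≈⟨ zeroˡ (y ⁻¹) ⟨
      0# * y ⁻¹    ≈⟨ *-congʳ 0≈xy ⟩
      x * y * y ⁻¹ ≈⟨ *-assoc x y (y ⁻¹) ⟩
      x * (y * y ⁻¹) ≈⟨ *-congˡ (⁻¹-inverseʳ y (proj₂ 0<y ∘ sym)) ⟩
      x * 1#       ≈⟨ *-identityʳ x ⟩
      x            ∎)

  *-monoˡ-< : ∀ {z x y} → 0# < z → x < y → z * x < z * y
  *-monoˡ-< {z} {x} {y} 0<z x<y = let d , 0<d , y≈x+d = <⇒∃+ x<y in begin-strict
    z * x         <⟨ x<x+y (z * x) (*-positive 0<z 0<d) ⟩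
    z * x + z * d ≈⟨ distribˡ z x d ⟨
    z * (x + d)   ≈⟨ *-congˡ y≈x+d ⟨
    z * y         ∎

  *-cancelˡ-≤ : ∀ {z x y} → 0# < z → z * x ≤ z * y → x ≤ y
  *-cancelˡ-≤ 0<z zx≤zy = ≮⇒≥ λ y<x → <⇒≱ (*-monoˡ-< 0<z y<x) zx≤zy

  *-cancelʳ-≤ : ∀ {z x y} → 0# < z → x * z ≤ y * z → x ≤ y
  *-cancelʳ-≤ {z} {x} {y} 0<z xz≤yz = *-cancelˡ-≤ 0<z (begin
    z * x ≈⟨ *-comm z x ⟩
    x * z ≤⟨ xz≤yz ⟩
    y * z ≈⟨ *-comm y z ⟩
    z * y ∎)

  x*x⁻¹≈1 : ∀ {x} → 0# < x → x * x ⁻¹ ≈ 1#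
  x*x⁻¹≈1 0<x = ⁻¹-inverseʳ _ (proj₂ 0<x ∘ sym)

  x⁻¹*x≈1 : ∀ {x} → 0# < x → x ⁻¹ * x ≈ 1#
  x⁻¹*x≈1 0<x = trans (*-comm _ _) (x*x⁻¹≈1 0<x)

  ⁻¹-positive : ∀ {x} → 0# < x → 0# < x ⁻¹
  ⁻¹-positive {x} 0<x = ≰⇒> λ x⁻¹≤0 → <⇒≱ 0<1 (begin
    1#       ≈⟨ x*x⁻¹≈1 0<x ⟨
    x * x ⁻¹ ≤⟨ *-monoˡ-≤ (<⇒≤ 0<x) x⁻¹≤0 ⟩
    x * 0#   ≈⟨ zeroʳ x ⟩
    0#       ∎)

  ⁻¹-anti-≤ : ∀ {x y} → 0# < x → x ≤ y → y ⁻¹ ≤ x ⁻¹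
  ⁻¹-anti-≤ {x} {y} 0<x x≤y = *-cancelˡ-≤ 0<x (begin
    x * y ⁻¹ ≤⟨ *-monoʳ-≤ (<⇒≤ (⁻¹-positive 0<y)) x≤y ⟩
    y * y ⁻¹ ≈⟨ x*x⁻¹≈1 0<y ⟩
    1#       ≈⟨ x*x⁻¹≈1 0<x ⟨
    x * x ⁻¹ ∎)
    where
    0<y : 0# < y
    0<y = begin-strict
      0# <⟨ 0<x ⟩
      x  ≤⟨ x≤y ⟩
      y  ∎

  ^-nonNegative : ∀ {x} → 0# ≤ x → ∀ n → 0# ≤ x ^ n
  ^-nonNegative 0≤x zero    = 0≤1
  ^-nonNegative 0≤x (suc n) = *-nonNegative 0≤x (^-nonNegative 0≤x n)

  ^-positive : ∀ {x} → 0# < x → ∀ n → 0# < x ^ n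
  ^-positive 0<x zero    = 0<1
  ^-positive 0<x (suc n) = *-positive 0<x (^-positive 0<x n)

  ^-monoˡ-≤ : ∀ {x y} → 0# ≤ x → x ≤ y → ∀ n → x ^ n ≤ y ^ n
  ^-monoˡ-≤ 0≤x x≤y zero    = ≤-refl
  ^-monoˡ-≤ 0≤x x≤y (suc n) =
    *-mono-≤ 0≤x (^-nonNegative (≤-trans 0≤x x≤y) n) x≤y (^-monoˡ-≤ 0≤x x≤y n)

  ^-monoˡ-< : ∀ {x y} → 0# ≤ x → x < y → ∀ n → x ^ suc n < y ^ suc n
  ^-monoˡ-< {x} {y} 0≤x x<y n = begin-strict
    x * x ^ n ≤⟨ *-monoˡ-≤ 0≤x (^-monoˡ-≤ 0≤x (<⇒≤ x<y) n) ⟩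
    x * y ^ n ≈⟨ *-comm x (y ^ n) ⟩
    y ^ n * x <⟨ *-monoˡ-< (^-positive 0<y n) x<y ⟩
    y ^ n * y ≈⟨ *-comm (y ^ n) y ⟩
    y * y ^ n ∎
    where
    0<y : 0# < y
    0<y = begin-strict
      0# ≤⟨ 0≤x ⟩
      x  <⟨ x<y ⟩
      y  ∎

  ^-cancelʳ-≤ : ∀ {x y n} → 0# ≤ y → 0 ℕ.< n → x ^ n ≤ y ^ n → x ≤ y
  ^-cancelʳ-≤ {n = suc n} 0≤y _ xⁿ≤yⁿ = ≮⇒≥ λ y<x → <⇒≱ (^-monoˡ-< 0≤y y<x n) xⁿ≤yⁿ

  1^n≈1 : ∀ n → 1# ^ n ≈ 1#
  1^n≈1 zero    = refl
  1^n≈1 (suc n) = trans (*-identityˡ _) (1^n≈1 n)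

  1≤x^n : ∀ {x} → 1# ≤ x → ∀ n → 1# ≤ x ^ n
  1≤x^n {x} 1≤x n = begin
    1#     ≈⟨ 1^n≈1 n ⟨
    1# ^ n ≤⟨ ^-monoˡ-≤ 0≤1 1≤x n ⟩
    x ^ n  ∎

  ^-monoʳ-≤ : ∀ {x} → 1# ≤ x → ∀ {m n} → m ℕ.≤ n → x ^ m ≤ x ^ n
  ^-monoʳ-≤ {x} 1≤x {n = n} z≤n     = 1≤x^n 1≤x n
  ^-monoʳ-≤ {x} 1≤x (s≤s m≤n) = *-monoˡ-≤ (≤-trans 0≤1 1≤x) (^-monoʳ-≤ 1≤x m≤n)

  ^-swap : ∀ x m n → (x ^ m) ^ n ≈ (x ^ n) ^ m
  ^-swap x m n = begin-equality
    (x ^ m) ^ n   ≈⟨ ^-assocʳ x m n ⟩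
    x ^ (m ℕ.* n) ≡⟨ ≡.cong (x ^_) (ℕ.*-comm m n) ⟩
    x ^ (n ℕ.* m) ≈⟨ ^-assocʳ x n m ⟨
    (x ^ n) ^ m   ∎

  fromℕ-+ : ∀ m n → fromℕ (m ℕ.+ n) ≈ fromℕ m + fromℕ n
  fromℕ-+ = Mult.×-homo-+ semiring 1#

  fromℕ-* : ∀ m n → fromℕ (m ℕ.* n) ≈ fromℕ m * fromℕ n
  fromℕ-* = Mult.×1-homo-* semiring

  fromℕ-1 : fromℕ 1 ≈ 1#
  fromℕ-1 = +-identityʳ 1#

  fromℕ-nonNegative : ∀ n → 0# ≤ fromℕ n
  fromℕ-nonNegative zero    = ≤-refl
  fromℕ-nonNegative (suc n) = +-nonNegative 0≤1 (fromℕ-nonNegative n)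

  fromℕ-mono-≤ : ∀ {m n} → m ℕ.≤ n → fromℕ m ≤ fromℕ n
  fromℕ-mono-≤ {n = n} z≤n = fromℕ-nonNegative n
  fromℕ-mono-≤ (s≤s m≤n)   = +-monoʳ-≤ 1# (fromℕ-mono-≤ m≤n)

  1≤fromℕ : ∀ {n} → 0 ℕ.< n → 1# ≤ fromℕ n
  1≤fromℕ {suc n} _ = x≤x+y 1# (fromℕ-nonNegative n)

  0<1≤ : ∀ {x} → 1# ≤ x → 0# < x
  0<1≤ {x} 1≤x = begin-strict
    0# <⟨ 0<1 ⟩
    1# ≤⟨ 1≤x ⟩
    x  ∎

  fromℕ-positive : ∀ {n} → 0 ℕ.< n → 0# < fromℕ n
  fromℕ-positive 0<n = 0<1≤ (1≤fromℕ 0<n)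

  fromℕ-cancel-≤ : ∀ {m n} → fromℕ m ≤ fromℕ n → m ℕ.≤ n
  fromℕ-cancel-≤ {zero}          _ = z≤n
  fromℕ-cancel-≤ {suc m} {zero}  p = contradiction p (<⇒≱ (fromℕ-positive {suc m} (s≤s z≤n)))
  fromℕ-cancel-≤ {suc m} {suc n} p = s≤s (fromℕ-cancel-≤ (+-cancelˡ-≤ 1# p))

  2# : Carrier
  2# = fromℕ 2

  2#-double : ∀ x → 2# * x ≈ x + x
  2#-double = solve 1 (λ x → (con 1 :+ (con 1 :+ con 0)) :* x := x :+ x) refl

  -- Used in the form n ^ (1/n) ≤ 2: a factor left over by rounding exponents becomes bounded once
  -- an n-th root is extracted.
  fromℕ≤2^ : ∀ n → fromℕ n ≤ 2# ^ n
  fromℕ≤2^ zero    = 0≤1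
  fromℕ≤2^ (suc n) = begin
    1# + fromℕ n      ≤⟨ +-mono-≤ (1≤x^n (1≤fromℕ {2} (s≤s z≤n)) n) (fromℕ≤2^ n) ⟩
    2# ^ n + 2# ^ n   ≈⟨ 2#-double (2# ^ n) ⟨
    2# * 2# ^ n       ∎

  -- The Archimedean property and rounding.

  -- If no natural number reached `x`, the naturals would have a supremum `u`; since n + 1 is again
  -- a natural number, u - 1 would be a smaller upper bound.
  archimedean : ∀ x → ∃ λ n → x ≤ fromℕ n
  archimedean x with em {∃ λ n → x ≤ fromℕ n}
  ... | yes p = p
  ... | no ¬p = contradiction (least (u + - 1#) shifted) u≰u-1
    where
    Naturals : Pred Carrier 0ℓ
    Naturals y = ∃ λ n → fromℕ n ≈ y
    bounded : UpperBound Naturals x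
    bounded y (n , n≈y) = ≮⇒≥ λ x<y →
      ¬p (n , ≤-trans (<⇒≤ x<y) (≤-reflexive (sym n≈y)))
    lub : ∃ (LeastUpperBound Naturals)
    lub = complete Naturals (0# , 0 , refl) (x , bounded)
    u     = proj₁ lub
    upper = proj₁ (proj₂ lub)
    least = proj₂ (proj₂ lub)
    shifted : UpperBound Naturals (u + - 1#)
    shifted y (n , n≈y) = +-cancelˡ-≤ 1# (begin
      1# + y             ≈⟨ +-congˡ n≈y ⟨
      fromℕ (suc n)      ≤⟨ upper _ (suc n , refl) ⟩
      u                  ≈⟨ x+[y-x]≈y 1# u ⟨
      1# + (u + - 1#)    ∎)
    u≰u-1 : ¬ u ≤ u + - 1#
    u≰u-1 = <⇒≱ (begin-strict
      u + - 1#         <⟨ x<x+y _ 0<1 ⟩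
      u + - 1# + 1#    ≈⟨ +-comm _ 1# ⟩
      1# + (u + - 1#)  ≈⟨ x+[y-x]≈y 1# u ⟩
      u                ∎)

  -- Both bounds are weak, so a positive integer may be rounded down to its predecessor; the later
  -- estimates rely on these two bounds alone.
  floor : ∀ {x} → 0# ≤ x → ∃ λ n → fromℕ n ≤ x × x ≤ fromℕ (suc n)
  floor {x} 0≤x = search (proj₁ (archimedean x)) (proj₂ (archimedean x))
    where
    search : ∀ m → x ≤ fromℕ m → ∃ λ n → fromℕ n ≤ x × x ≤ fromℕ (suc n)
    search zero    x≤0 = 0 , 0≤x , ≤-trans x≤0 (fromℕ-nonNegative 1)
    search (suc m) x≤1+m with total x (fromℕ m)
    ... | inj₁ x≤m = search m x≤m
    ... | inj₂ m≤x = m , m≤x , x≤1+m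

  ceiling : ∀ {x} → 0# ≤ x → ∃ λ n → x ≤ fromℕ n × fromℕ n ≤ x + 1#
  ceiling {x} 0≤x = let n , n≤x , x≤1+n = floor 0≤x in
    suc n , x≤1+n , ≤-trans (≤-reflexive (+-comm _ _)) (+-mono-≤ n≤x ≤-refl)

  -- Roots of positive numbers.

  -- The product rule, by induction; the constant unfolds to n B ^ (n - 1). Increments `δ` in place
  -- of differences keep the induction free of subtraction.
  ^-lipschitz : ∀ {B} → 0# ≤ B → ∀ n → ∃ λ K → 0# ≤ K ×
    (∀ x δ → 0# ≤ x → 0# ≤ δ → x + δ ≤ B → (x + δ) ^ n ≤ x ^ n + δ * K)
  ^-lipschitz {B} 0≤B zero = 0# , ≤-refl , λ x δ _ _ _ → begin
    1#          ≈⟨ +-identityʳ 1# ⟨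
    1# + 0#     ≈⟨ +-congˡ (zeroʳ δ) ⟨
    1# + δ * 0# ∎
  ^-lipschitz {B} 0≤B (suc n) with ^-lipschitz 0≤B n
  ... | K , 0≤K , bound = B ^ n + B * K
    , +-nonNegative (^-nonNegative 0≤B n) (*-nonNegative 0≤B 0≤K)
    , λ x δ 0≤x 0≤δ x+δ≤B → begin
      (x + δ) * (x + δ) ^ n
        ≤⟨ *-monoˡ-≤ (+-nonNegative 0≤x 0≤δ) (bound x δ 0≤x 0≤δ x+δ≤B) ⟩
      (x + δ) * (x ^ n + δ * K)
        ≈⟨ solve 4 (λ x δ y K → (x :+ δ) :* (y :+ δ :* K) := x :* y :+ δ :* (y :+ (x :+ δ) :* K)) refl x δ (x ^ n) K ⟩
      x * x ^ n + δ * (x ^ n + (x + δ) * K)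
        ≤⟨ +-monoʳ-≤ _ (*-monoˡ-≤ 0≤δ (+-mono-≤
             (^-monoˡ-≤ 0≤x (≤-trans (x≤x+y x 0≤δ) x+δ≤B) n)
             (*-monoʳ-≤ 0≤K x+δ≤B))) ⟩
      x * x ^ n + δ * (B ^ n + B * K) ∎

  smallStep : ∀ {m K ε} → 0# < m → 0# ≤ K → 0# < ε →
              ∃ λ δ → 0# < δ × δ ≤ m × δ * K ≤ ε
  smallStep {m} {K} {ε} 0<m 0≤K 0<ε = δ , 0<δ
    , *-cancelʳ-≤ 0<ε (begin
        δ * ε           ≤⟨ *-monoˡ-≤ (<⇒≤ 0<δ) (y≤x+y ε 0≤mK) ⟩
        δ * (m * K + ε) ≈⟨ δs≈mε ⟩
        m * ε           ∎)
    , *-cancelˡ-≤ 0<m (begin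
        m * (δ * K)     ≈⟨ solve 3 (λ m δ K → m :* (δ :* K) := δ :* (m :* K)) refl m δ K ⟩
        δ * (m * K)     ≤⟨ *-monoˡ-≤ (<⇒≤ 0<δ) (x≤x+y _ (<⇒≤ 0<ε)) ⟩
        δ * (m * K + ε) ≈⟨ δs≈mε ⟩
        m * ε           ∎)
    where
    0≤mK = *-nonNegative (<⇒≤ 0<m) 0≤K
    0<s : 0# < m * K + ε
    0<s = begin-strict
      0#        <⟨ 0<ε ⟩
      ε         ≤⟨ y≤x+y ε 0≤mK ⟩
      m * K + ε ∎
    -- Here 1/δ = 1/m + K/ε: a single value below both `m` and ε/K that stays meaningful for K = 0,
    -- so that neither a minimum nor a case distinction arises.
    δ = m * ε * (m * K + ε) ⁻¹
    0<δ : 0# < δ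
    0<δ = *-positive (*-positive 0<m 0<ε) (⁻¹-positive 0<s)
    δs≈mε : δ * (m * K + ε) ≈ m * ε
    δs≈mε = begin-equality
      m * ε * (m * K + ε) ⁻¹ * (m * K + ε)   ≈⟨ *-assoc _ _ _ ⟩
      m * ε * ((m * K + ε) ⁻¹ * (m * K + ε)) ≈⟨ *-congˡ (x⁻¹*x≈1 0<s) ⟩
      m * ε * 1#                             ≈⟨ *-identityʳ _ ⟩
      m * ε                                  ∎

  -- Serves `root`: a supremum `x` with `x ^ n < y` would leave room for the larger base `x + δ`.
  -- The opposite inequality is excluded by `^-decrease`.
  ^-increase : ∀ {x y} → 0# ≤ x → ∀ n → x ^ n < y → ∃ λ δ → 0# < δ × (x + δ) ^ n ≤ y
  ^-increase {x} {y} 0≤x n xⁿ<y =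
    let ε , 0<ε , y≈xⁿ+ε       = <⇒∃+ xⁿ<y
        K , 0≤K , bound        = ^-lipschitz (+-nonNegative 0≤x 0≤1) n
        δ , 0<δ , δ≤1 , δK≤ε   = smallStep 0<1 0≤K 0<ε
    in δ , 0<δ , (begin
    (x + δ) ^ n   ≤⟨ bound x δ 0≤x (<⇒≤ 0<δ) (+-monoʳ-≤ x δ≤1) ⟩
    x ^ n + δ * K ≤⟨ +-monoʳ-≤ _ δK≤ε ⟩
    x ^ n + ε     ≈⟨ y≈xⁿ+ε ⟨
    y             ∎)

  ^-decrease : ∀ {x y} → 0# < x → ∀ n → y < x ^ n → ∃ λ z → 0# ≤ z × z < x × y ≤ z ^ n
  ^-decrease {x} {y} 0<x n y<xⁿ =
    let ε , 0<ε , xⁿ≈y+ε     = <⇒∃+ y<xⁿ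
        K , 0≤K , bound      = ^-lipschitz (<⇒≤ 0<x) n
        -- The bound `δ≤x` keeps z = x - δ nonnegative.
        δ , 0<δ , δ≤x , δK≤ε = smallStep 0<x 0≤K 0<ε
        z , 0≤z , x≈δ+z      = ≤⇒∃+ δ≤x
        x≈z+δ                = trans x≈δ+z (+-comm δ z)
    in z , 0≤z
    , (begin-strict
        z     <⟨ x<x+y z 0<δ ⟩
        z + δ ≈⟨ x≈z+δ ⟨
        x     ∎)
    , +-cancelʳ-≤ ε (begin
        y + ε         ≈⟨ xⁿ≈y+ε ⟨
        x ^ n         ≈⟨ ^-congˡ n x≈z+δ ⟩
        (z + δ) ^ n   ≤⟨ bound z δ 0≤z (<⇒≤ 0<δ) (≤-reflexive (sym x≈z+δ)) ⟩
        z ^ n + δ * K ≤⟨ +-monoʳ-≤ _ δK≤ε ⟩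
        z ^ n + ε     ∎)

  root : ∀ {y} → 0# < y → ∀ n → 0 ℕ.< n → ∃ λ z → 0# < z × z ^ n ≈ y
  root {y} 0<y n@(suc n-1) 0<n = x , 0<x , antisym (≮⇒≥ y≮xⁿ) (≮⇒≥ xⁿ≮y)
    where
    0≤y : 0# ≤ y
    0≤y = <⇒≤ 0<y
    0≤1+y : 0# ≤ 1# + y
    0≤1+y = +-nonNegative 0≤1 0≤y
    Below : Pred Carrier 0ℓ
    Below z = 0# ≤ z × z ^ n ≤ y
    0∈Below : Below 0#
    0∈Below = ≤-refl , ≤-trans (≤-reflexive (zeroˡ _)) 0≤y
    bounded : UpperBound Below (1# + y)
    bounded z (0≤z , zⁿ≤y) = ^-cancelʳ-≤ 0≤1+y 0<n (begin
      z ^ n                       ≤⟨ zⁿ≤y ⟩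
      y                           ≈⟨ *-identityʳ y ⟨
      y * 1#                      ≤⟨ *-mono-≤ 0≤y (^-nonNegative 0≤1+y n-1) (y≤x+y y 0≤1) (1≤x^n (x≤x+y 1# 0≤y) n-1) ⟩
      (1# + y) * (1# + y) ^ n-1   ∎)
    lub : ∃ (LeastUpperBound Below)
    lub = complete Below (0# , 0∈Below) (1# + y , bounded)
    x : Carrier
    x = proj₁ lub
    upper : UpperBound Below x
    upper = proj₁ (proj₂ lub)
    0≤x : 0# ≤ x
    0≤x = upper 0# 0∈Below
    xⁿ≮y : ¬ x ^ n < y
    xⁿ≮y xⁿ<y = let δ , 0<δ , [x+δ]ⁿ≤y = ^-increase 0≤x n xⁿ<y in
      <⇒≱ (x<x+y x 0<δ) (upper (x + δ) (+-nonNegative 0≤x (<⇒≤ 0<δ) , [x+δ]ⁿ≤y))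
    -- Positivity of the supremum follows from the case just refuted, because 0 ^ n = 0 < y.
    0<x : 0# < x
    0<x = 0≤x , λ 0≈x → xⁿ≮y (begin-strict
      x * x ^ n-1  ≈⟨ *-congʳ 0≈x ⟨
      0# * x ^ n-1 ≈⟨ zeroˡ _ ⟩
      0#           <⟨ 0<y ⟩
      y            ∎)
    y≮xⁿ : ¬ y < x ^ n
    y≮xⁿ y<xⁿ = let x′ , 0≤x′ , x′<x , y≤x′ⁿ = ^-decrease 0<x n y<xⁿ in
      <⇒≱ x′<x (proj₂ (proj₂ lub) x′ λ z (0≤z , zⁿ≤y) →
        ^-cancelʳ-≤ 0≤x′ 0<n (≤-trans zⁿ≤y y≤x′ⁿ))

-- Real powers as suprema of rational powers.

module RealPower (em : ExcludedMiddle 0ℓ) (R : CompleteOrderedField) where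

  open OrderedField em R
  open Classical em R

  *-interchange : ∀ w x y z → w * x * (y * z) ≈ w * y * (x * z)
  *-interchange = solve 4 (λ w x y z → w :* x :* (y :* z) := w :* y :* (x :* z)) refl

  -- The two hypotheses exclude the branch in which `sup` takes its default value 0.
  sup-isLub : (P : Pred Carrier 0ℓ) → ∃ P → ∃ (UpperBound P) → LeastUpperBound P (sup P)
  sup-isLub P inh bdd with em {∃ P} | em {∃ (UpperBound P)}
  ... | yes i  | yes b  = proj₂ (complete P i b)
  ... | no  ¬i | _      = contradiction inh ¬i
  ... | yes _  | no  ¬b = contradiction bdd ¬b

  module _ {b : Carrier} (1≤b : 1# ≤ b) where

    private
      0<b : 0# < b
      0<b = 0<1≤ 1≤b

    -- Think of z as b ^ ((i - j) / k). Raising to the power `k` and multiplying by `(b ^ j) ^ d`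
    -- clears the denominator and the negative part, and two natural powers of `b` remain. Their
    -- exponents are compared inside the field, where the two hypotheses on `x` combine.
    rationalPower-upper : ∀ {x z} d e c → fromℕ d * x + fromℕ e ≤ fromℕ c →
                          RationalPower b x z → z ^ d * b ^ e ≤ b ^ c
    rationalPower-upper {x} {z} d e c dx+e≤c (0<z , i , j , k , 0<k , i≤kx+j , zᵏbʲ≈bⁱ) =
      ^-cancelʳ-≤ (^-nonNegative (<⇒≤ 0<b) c) 0<k
        (*-cancelʳ-≤ (^-positive (^-positive 0<b j) d) (begin
          (z ^ d * b ^ e) ^ k * (b ^ j) ^ d
            ≈⟨ *-congʳ (^-distrib-* (z ^ d) (b ^ e) k) ⟩
          (z ^ d) ^ k * (b ^ e) ^ k * (b ^ j) ^ d
            ≈⟨ *-congʳ (*-congʳ (^-swap z d k)) ⟩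
          (z ^ k) ^ d * (b ^ e) ^ k * (b ^ j) ^ d
            ≈⟨ solve 3 (λ x y z → x :* y :* z := x :* z :* y) refl _ _ _ ⟩
          (z ^ k) ^ d * (b ^ j) ^ d * (b ^ e) ^ k
            ≈⟨ *-congʳ (^-distrib-* (z ^ k) (b ^ j) d) ⟨
          (z ^ k * b ^ j) ^ d * (b ^ e) ^ k
            ≈⟨ *-congʳ (^-congˡ d zᵏbʲ≈bⁱ) ⟩
          (b ^ i) ^ d * (b ^ e) ^ k
            ≈⟨ powers i d e k ⟩
          b ^ (i ℕ.* d ℕ.+ e ℕ.* k)
            ≤⟨ ^-monoʳ-≤ 1≤b exponents ⟩
          b ^ (c ℕ.* k ℕ.+ j ℕ.* d)
            ≈⟨ powers c k j d ⟨
          (b ^ c) ^ k * (b ^ j) ^ d ∎))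
      where
      powers : ∀ l m n o → (b ^ l) ^ m * (b ^ n) ^ o ≈ b ^ (l ℕ.* m ℕ.+ n ℕ.* o)
      powers l m n o = begin-equality
        (b ^ l) ^ m * (b ^ n) ^ o       ≈⟨ *-cong (^-assocʳ b l m) (^-assocʳ b n o) ⟩
        b ^ (l ℕ.* m) * b ^ (n ℕ.* o)   ≈⟨ ^-homo-* b (l ℕ.* m) (n ℕ.* o) ⟨
        b ^ (l ℕ.* m ℕ.+ n ℕ.* o)       ∎
      cast : ∀ l m n o → fromℕ (l ℕ.* m ℕ.+ n ℕ.* o) ≈ fromℕ l * fromℕ m + fromℕ n * fromℕ o
      cast l m n o = trans (fromℕ-+ (l ℕ.* m) (n ℕ.* o)) (+-cong (fromℕ-* l m) (fromℕ-* n o))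
      exponents : i ℕ.* d ℕ.+ e ℕ.* k ℕ.≤ c ℕ.* k ℕ.+ j ℕ.* d
      exponents = fromℕ-cancel-≤ (begin
        fromℕ (i ℕ.* d ℕ.+ e ℕ.* k)
          ≈⟨ cast i d e k ⟩
        fromℕ i * fromℕ d + fromℕ e * fromℕ k
          ≤⟨ +-mono-≤ (*-monoʳ-≤ (fromℕ-nonNegative d) i≤kx+j) ≤-refl ⟩
        (fromℕ k * x + fromℕ j) * fromℕ d + fromℕ e * fromℕ k
          ≈⟨ solve 5 (λ k x j d e → (k :* x :+ j) :* d :+ e :* k := (d :* x :+ e) :* k :+ j :* d)
               refl (fromℕ k) x (fromℕ j) (fromℕ d) (fromℕ e) ⟩
        (fromℕ d * x + fromℕ e) * fromℕ k + fromℕ j * fromℕ d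
          ≤⟨ +-mono-≤ (*-monoʳ-≤ (fromℕ-nonNegative k) dx+e≤c) ≤-refl ⟩
        fromℕ c * fromℕ k + fromℕ j * fromℕ d
          ≈⟨ cast c k j d ⟨
        fromℕ (c ℕ.* k ℕ.+ j ℕ.* d) ∎)

    -- The final equation repeats the one inside `RationalPower`, whose existentials would otherwise
    -- hide the chosen `i`, `j` and `k` from the caller.
    rationalPower : ∀ {x} i j k → 0 ℕ.< k → fromℕ i ≤ fromℕ k * x + fromℕ j →
                    ∃ λ z → RationalPower b x z × z ^ k * b ^ j ≈ b ^ i
    rationalPower i j k 0<k i≤kx+j =
      let y = b ^ i * (b ^ j) ⁻¹
          z , 0<z , zᵏ≈y = root (*-positive (^-positive 0<b i) (⁻¹-positive (^-positive 0<b j))) k 0<k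
          zᵏbʲ≈bⁱ = begin-equality
            z ^ k * b ^ j                 ≈⟨ *-congʳ zᵏ≈y ⟩
            b ^ i * (b ^ j) ⁻¹ * b ^ j    ≈⟨ *-assoc _ _ _ ⟩
            b ^ i * ((b ^ j) ⁻¹ * b ^ j)  ≈⟨ *-congˡ (x⁻¹*x≈1 (^-positive 0<b j)) ⟩
            b ^ i * 1#                    ≈⟨ *-identityʳ _ ⟩
            b ^ i                         ∎
      in z , (0<z , i , j , k , 0<k , i≤kx+j , zᵏbʲ≈bⁱ) , zᵏbʲ≈bⁱ

    rationalPower-inhabited : ∀ x → ∃ (RationalPower b x)
    rationalPower-inhabited x =
      -- The integer -j is an exponent below x with denominator 1.
      let j , -x≤j = archimedean (- x)
          z , Pz , _ = rationalPower 0 j 1 (s≤s z≤n) (begin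
            0#                    ≈⟨ -‿inverseʳ x ⟨
            x + - x               ≤⟨ +-monoʳ-≤ x -x≤j ⟩
            x + fromℕ j           ≈⟨ +-congʳ (trans (*-congʳ fromℕ-1) (*-identityˡ x)) ⟨
            fromℕ 1 * x + fromℕ j ∎)
      in z , Pz

    ^ᴿ-isLub : ∀ x → LeastUpperBound (RationalPower b x) (b ^ᴿ x)
    ^ᴿ-isLub x = sup-isLub _ (rationalPower-inhabited x) (b ^ c , λ z Pz → begin
      z             ≈⟨ solve 1 (λ z → z := z :^ 1 :* con 1) refl z ⟩
      z ^ 1 * b ^ 0 ≤⟨ rationalPower-upper 1 0 c x≤c Pz ⟩
      b ^ c         ∎)
      where
      c = proj₁ (archimedean x)
      x≤c : fromℕ 1 * x + fromℕ 0 ≤ fromℕ c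
      x≤c = begin
        fromℕ 1 * x + 0# ≈⟨ solve 1 (λ x → (con 1 :+ con 0) :* x :+ con 0 := x) refl x ⟩
        x                ≤⟨ proj₂ (archimedean x) ⟩
        fromℕ c          ∎

    ^ᴿ-positive : ∀ x → 0# < b ^ᴿ x
    ^ᴿ-positive x = let z , Pz = rationalPower-inhabited x in begin-strict
      0#     <⟨ proj₁ Pz ⟩
      z      ≤⟨ proj₁ (^ᴿ-isLub x) z Pz ⟩
      b ^ᴿ x ∎

    -- Takes the place of (b ^ x) ^ d = b ^ (d x) in estimates from above: the number b ^ ((c - e) /
    -- d) bounds every rational power, by `rationalPower-upper`, and hence their supremum.
    ^ᴿ-upper : ∀ {x} d e c → 0 ℕ.< d → fromℕ d * x + fromℕ e ≤ fromℕ c →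
               (b ^ᴿ x) ^ d * b ^ e ≤ b ^ c
    ^ᴿ-upper {x} d e c 0<d dx+e≤c =
      let 0<bᵉ = ^-positive 0<b e
          y , 0<y , yᵈ≈ = root (*-positive (^-positive 0<b c) (⁻¹-positive 0<bᵉ)) d 0<d
          yᵈbᵉ≈bᶜ = begin-equality
            y ^ d * b ^ e                 ≈⟨ *-congʳ yᵈ≈ ⟩
            b ^ c * (b ^ e) ⁻¹ * b ^ e    ≈⟨ *-assoc _ _ _ ⟩
            b ^ c * ((b ^ e) ⁻¹ * b ^ e)  ≈⟨ *-congˡ (x⁻¹*x≈1 0<bᵉ) ⟩
            b ^ c * 1#                    ≈⟨ *-identityʳ _ ⟩
            b ^ c                         ∎
          bˣ≤y = proj₂ (^ᴿ-isLub x) y λ z Pz →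
            ^-cancelʳ-≤ (<⇒≤ 0<y) 0<d (*-cancelʳ-≤ 0<bᵉ (begin
              z ^ d * b ^ e ≤⟨ rationalPower-upper d e c dx+e≤c Pz ⟩
              b ^ c         ≈⟨ yᵈbᵉ≈bᶜ ⟨
              y ^ d * b ^ e ∎))
      in begin
        (b ^ᴿ x) ^ d * b ^ e ≤⟨ *-monoʳ-≤ (<⇒≤ 0<bᵉ) (^-monoˡ-≤ (<⇒≤ (^ᴿ-positive x)) bˣ≤y d) ⟩
        y ^ d * b ^ e        ≈⟨ yᵈbᵉ≈bᶜ ⟩
        b ^ c                ∎

    -- The counterpart from below: b ^ ((i - j) / k) is itself one of the rational powers whose
    -- supremum is taken.
    ^ᴿ-lower : ∀ {x} i j k → 0 ℕ.< k → fromℕ i ≤ fromℕ k * x + fromℕ j →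
               b ^ i ≤ (b ^ᴿ x) ^ k * b ^ j
    ^ᴿ-lower {x} i j k 0<k i≤kx+j =
      let z , Pz , zᵏbʲ≈bⁱ = rationalPower i j k 0<k i≤kx+j in begin
        b ^ i                ≈⟨ zᵏbʲ≈bⁱ ⟨
        z ^ k * b ^ j        ≤⟨ *-monoʳ-≤ (<⇒≤ (^-positive 0<b j))
                                  (^-monoˡ-≤ (<⇒≤ (proj₁ Pz)) (proj₁ (^ᴿ-isLub x) z Pz) k) ⟩
        (b ^ᴿ x) ^ k * b ^ j ∎

  -- A rational power of `c` is the product of the powers of `a` and `b` with the same exponent,
  -- since positive k-th roots are unique; each factor lies below its own supremum.
  ^ᴿ-submultiplicative : ∀ {a b c} → 1# ≤ a → 1# ≤ b → c ≈ a * b →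
                         ∀ x → c ^ᴿ x ≤ a ^ᴿ x * b ^ᴿ x
  ^ᴿ-submultiplicative {a} {b} {c} 1≤a 1≤b c≈ab x =
    proj₂ (^ᴿ-isLub 1≤c x) _ λ z (0<z , i , j , k , 0<k , i≤kx+j , zᵏcʲ≈cⁱ) →
      let u , Pu , uᵏaʲ≈aⁱ = rationalPower 1≤a i j k 0<k i≤kx+j
          v , Pv , vᵏbʲ≈bⁱ = rationalPower 1≤b i j k 0<k i≤kx+j
          0<u = proj₁ Pu
          0<v = proj₁ Pv
      in begin
        z               ≤⟨ ^-cancelʳ-≤ (<⇒≤ (*-positive 0<u 0<v)) 0<k
                             (*-cancelʳ-≤ (^-positive (0<1≤ 1≤c) j) (≤-reflexive (begin-equality
          z ^ k * c ^ j               ≈⟨ zᵏcʲ≈cⁱ ⟩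
          c ^ i                       ≈⟨ ^-congˡ i c≈ab ⟩
          (a * b) ^ i                 ≈⟨ ^-distrib-* a b i ⟩
          a ^ i * b ^ i               ≈⟨ *-cong uᵏaʲ≈aⁱ vᵏbʲ≈bⁱ ⟨
          u ^ k * a ^ j * (v ^ k * b ^ j) ≈⟨ *-interchange _ _ _ _ ⟩
          u ^ k * v ^ k * (a ^ j * b ^ j) ≈⟨ *-cong (^-distrib-* u v k) (^-distrib-* a b j) ⟨
          (u * v) ^ k * (a * b) ^ j       ≈⟨ *-congˡ (^-congˡ j c≈ab) ⟨
          (u * v) ^ k * c ^ j             ∎))) ⟩
        u * v           ≤⟨ *-mono-≤ (<⇒≤ 0<u) (<⇒≤ (^ᴿ-positive 1≤b x))
                             (proj₁ (^ᴿ-isLub 1≤a x) u Pu) (proj₁ (^ᴿ-isLub 1≤b x) v Pv) ⟩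
        a ^ᴿ x * b ^ᴿ x ∎
    where
    1≤c : 1# ≤ c
    1≤c = begin
      1#     ≤⟨ 1≤a ⟩
      a      ≈⟨ *-identityʳ a ⟨
      a * 1# ≤⟨ *-monoˡ-≤ (<⇒≤ (0<1≤ 1≤a)) 1≤b ⟩
      a * b  ≈⟨ c≈ab ⟨
      c      ∎

-- Estimates for powers with the exponents -1/α and 1 + 1/α.

module Exponent (em : ExcludedMiddle 0ℓ) (R : CompleteOrderedField)
  (α : CompleteOrderedField.Carrier R)
  (1≤α : CompleteOrderedField._≤_ R (CompleteOrderedField.1# R) α) where

  open OrderedField em R
  open RealPower em R
  open Classical em R

  β : Carrier
  β = α ⁻¹

  h : ℕ → Carrier
  h n = fromℕ n ^ᴿ (- β)

  0<α : 0# < α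
  0<α = 0<1≤ 1≤α

  0<β : 0# < β
  0<β = ⁻¹-positive 0<α

  β≤1 : β ≤ 1#
  β≤1 = begin
    β      ≈⟨ *-identityʳ β ⟨
    β * 1# ≤⟨ *-monoˡ-≤ (<⇒≤ 0<β) 1≤α ⟩
    β * α  ≈⟨ x⁻¹*x≈1 0<α ⟩
    1#     ∎

  -- Rids the exponent condition of `^ᴿ-upper` of its negation; `-β-lower` does the same for
  -- `^ᴿ-lower`.
  -β-upper : ∀ {y v w} → v ≤ w + y * β → y * - β + v ≤ w
  -β-upper {y} {v} {w} v≤w+yβ = begin
    y * - β + v             ≤⟨ +-monoʳ-≤ _ v≤w+yβ ⟩
    y * - β + (w + y * β)   ≈⟨ solve 3 (λ a b c → a :+ (b :+ c) := (a :+ c) :+ b) refl _ _ _ ⟩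
    y * - β + y * β + w     ≈⟨ +-congʳ (x*-y+x*y≈0 y β) ⟩
    0# + w                  ≈⟨ +-identityˡ w ⟩
    w                       ∎

  -β-lower : ∀ {y v w} → v + y * β ≤ w → v ≤ y * - β + w
  -β-lower {y} {v} {w} v+yβ≤w = begin
    v                       ≈⟨ +-identityˡ v ⟨
    0# + v                  ≈⟨ +-congʳ (x*-y+x*y≈0 y β) ⟨
    y * - β + y * β + v     ≈⟨ solve 3 (λ a b c → (a :+ c) :+ b := a :+ (b :+ c)) refl _ _ _ ⟩
    y * - β + (v + y * β)   ≤⟨ +-monoʳ-≤ _ v+yβ≤w ⟩
    y * - β + w             ∎

  h-positive : ∀ {n} → 0 ℕ.< n → 0# < h n
  h-positive 0<n = ^ᴿ-positive (1≤fromℕ 0<n) (- β)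

  h≤1 : ∀ {n} → 0 ℕ.< n → h n ≤ 1#
  h≤1 {n} 0<n = begin
    h n                       ≈⟨ solve 1 (λ z → z := z :^ 1 :* con 1) refl (h n) ⟩
    h n ^ 1 * fromℕ n ^ 0     ≤⟨ ^ᴿ-upper (1≤fromℕ 0<n) 1 0 0 (s≤s z≤n) (-β-upper (+-nonNegative ≤-refl
                                   (*-nonNegative (fromℕ-nonNegative 1) (<⇒≤ 0<β)))) ⟩
    1#                        ∎

  h<1 : ∀ {n} → 1 ℕ.< n → h n < 1#
  h<1 {n} 1<n = ≰⇒> λ 1≤h → ℕ.<⇒≱ 1<n (fromℕ-cancel-≤ (begin
    fromℕ n                   ≈⟨ solve 1 (λ z → z := con 1 :* z :^ 1) refl (fromℕ n) ⟩
    1# * fromℕ n ^ 1          ≤⟨ *-monoʳ-≤ (^-nonNegative (fromℕ-nonNegative n) 1) (1≤x^n 1≤h d) ⟩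
    h n ^ d * fromℕ n ^ 1     ≤⟨ ^ᴿ-upper (1≤fromℕ 0<n) d 1 0 0<d (-β-upper (begin
      fromℕ 1                 ≈⟨ fromℕ-1 ⟩
      1#                      ≈⟨ x*x⁻¹≈1 0<α ⟨
      α * β                   ≤⟨ *-monoʳ-≤ (<⇒≤ 0<β) α≤d ⟩
      fromℕ d * β             ≈⟨ +-identityˡ _ ⟨
      0# + fromℕ d * β        ∎)) ⟩
    1#                        ≈⟨ fromℕ-1 ⟨
    fromℕ 1                   ∎))
    where
    0<n = ℕ.<-trans (s≤s z≤n) 1<n
    d = proj₁ (archimedean α)
    α≤d = proj₂ (archimedean α)
    0<d : 0 ℕ.< d
    0<d = fromℕ-cancel-≤ (≤-trans (≤-reflexive fromℕ-1) (≤-trans 1≤α α≤d))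

  h-submultiplicative : ∀ {m n} → 0 ℕ.< m → 0 ℕ.< n → h (m ℕ.* n) ≤ h m * h n
  h-submultiplicative {m} {n} 0<m 0<n =
    ^ᴿ-submultiplicative (1≤fromℕ 0<m) (1≤fromℕ 0<n) (fromℕ-* m n) (- β)

  -- Both exponents are replaced by rationals with denominator K = n J; the
  -- rounding errors contribute the factor n ^ (K * J) ≤ 2 ^ (K * K).
  h-lower : ∀ C → ∃ λ D → 0# < D × (∀ {s n} → 0 ℕ.< s → 0 ℕ.< n →
            fromℕ s ≤ C * fromℕ n ^ᴿ α → 1# ≤ h s * fromℕ n * D)
  h-lower C = A * A * 2# , *-positive (*-positive 0<A 0<A) (fromℕ-positive {2} (s≤s z≤n)) , bound
    where
    -- Taking the successor of `a` ensures 1 ≤ A, so that powers of `A` grow with the exponent.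
    a = proj₁ (archimedean C)
    A : Carrier
    A = fromℕ (suc a)
    1≤A : 1# ≤ A
    1≤A = 1≤fromℕ {suc a} (s≤s z≤n)
    0<A : 0# < A
    0<A = 0<1≤ 1≤A
    C≤A : C ≤ A
    C≤A = ≤-trans (proj₂ (archimedean C)) (fromℕ-mono-≤ (ℕ.n≤1+n a))
    -- The exponent c * j is at most (K α + 1)(K β + 1) = K * K + (α + β) K + 1; as 1 ≤ K, the last
    -- two terms are absorbed by J * K.
    J = proj₁ (archimedean (α + β + 1#))
    α+β+1≤J : α + β + 1# ≤ fromℕ J
    α+β+1≤J = proj₂ (archimedean (α + β + 1#))
    0<J : 0 ℕ.< J
    0<J = fromℕ-cancel-≤ (begin
      fromℕ 1    ≈⟨ fromℕ-1 ⟩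
      1#         ≤⟨ y≤x+y 1# (+-nonNegative (<⇒≤ 0<α) (<⇒≤ 0<β)) ⟩
      α + β + 1# ≤⟨ α+β+1≤J ⟩
      fromℕ J    ∎)
    bound : ∀ {s n} → 0 ℕ.< s → 0 ℕ.< n →
            fromℕ s ≤ C * fromℕ n ^ᴿ α → 1# ≤ h s * fromℕ n * (A * A * 2#)
    bound {s} {n} 0<s 0<n s≤Cnᵅ =
      -- Two successive K-th powers are taken: one for rounding β to j / K, one for rounding α to c
      -- / K.
      ^-cancelʳ-≤ 0≤B 0<K (^-cancelʳ-≤ (^-nonNegative 0≤B K) 0<K (begin
        (1# ^ K) ^ K
          ≈⟨ trans (^-congˡ K (1^n≈1 K)) (1^n≈1 K) ⟩
        1#
          ≈⟨ 1^n≈1 K ⟨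
        1# ^ K
          ≤⟨ ^-monoˡ-≤ 0≤1 (^ᴿ-lower (1≤fromℕ 0<s) 0 j K 0<K
               (-β-lower (≤-trans (≤-reflexive (+-identityˡ _)) Kβ≤j))) K ⟩
        (h s ^ K * S ^ j) ^ K
          ≈⟨ trans (^-distrib-* (h s ^ K) (S ^ j) K) (*-congˡ (^-swap S j K)) ⟩
        (h s ^ K) ^ K * (S ^ K) ^ j
          ≤⟨ *-monoˡ-≤ (^-nonNegative (^-nonNegative 0≤h K) K) (^-monoˡ-≤ (^-nonNegative (fromℕ-nonNegative s) K) S^K≤ j) ⟩
        (h s ^ K) ^ K * (A ^ K * N ^ c) ^ j
          ≈⟨ *-congˡ (trans (^-distrib-* (A ^ K) (N ^ c) j) (*-cong (^-swap A K j) (^-assocʳ N c j))) ⟩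
        (h s ^ K) ^ K * ((A ^ j) ^ K * N ^ (c ℕ.* j))
          ≤⟨ *-monoˡ-≤ (^-nonNegative (^-nonNegative 0≤h K) K)
               (*-mono-≤ (^-nonNegative (^-nonNegative 0≤A j) K)
                         (*-nonNegative (^-nonNegative (^-nonNegative 0≤N K) K) (^-nonNegative (^-nonNegative 0≤2 K) K))
                         A^j≤ N^cj≤) ⟩
        (h s ^ K) ^ K * (((A * A) ^ K) ^ K * ((N ^ K) ^ K * (2# ^ K) ^ K))
          ≈⟨ solve 4 (λ a b c d → a :* (b :* (c :* d)) := (a :* c) :* (b :* d)) refl _ _ _ _ ⟩
        (h s ^ K) ^ K * (N ^ K) ^ K * (((A * A) ^ K) ^ K * (2# ^ K) ^ K)
          ≈⟨ *-cong (distrib² (h s) N) (distrib² (A * A) 2#) ⟨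
        ((h s * N) ^ K) ^ K * ((A * A * 2#) ^ K) ^ K
          ≈⟨ distrib² (h s * N) (A * A * 2#) ⟨
        ((h s * N * (A * A * 2#)) ^ K) ^ K ∎))
      where
      S = fromℕ s
      N = fromℕ n
      K = n ℕ.* J
      0≤A = <⇒≤ 0<A
      0≤N = fromℕ-nonNegative n
      0≤2 = fromℕ-nonNegative 2
      0≤h = <⇒≤ (h-positive 0<s)
      0≤K = fromℕ-nonNegative K
      0≤B : 0# ≤ h s * N * (A * A * 2#)
      0≤B = *-nonNegative (*-nonNegative 0≤h 0≤N) (*-nonNegative (*-nonNegative 0≤A 0≤A) 0≤2)
      0<K : 0 ℕ.< K
      0<K = ℕ.*-mono-≤ 0<n 0<J
      1≤K : 1# ≤ fromℕ K
      1≤K = 1≤fromℕ 0<K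
      cBound = ceiling (*-nonNegative 0≤K (<⇒≤ 0<α))
      c = proj₁ cBound
      jBound = ceiling (*-nonNegative 0≤K (<⇒≤ 0<β))
      j = proj₁ jBound
      Kβ≤j = proj₁ (proj₂ jBound)
      distrib² : ∀ x y → ((x * y) ^ K) ^ K ≈ (x ^ K) ^ K * (y ^ K) ^ K
      distrib² x y = trans (^-congˡ K (^-distrib-* x y K)) (^-distrib-* (x ^ K) (y ^ K) K)
      S^K≤ : S ^ K ≤ A ^ K * N ^ c
      S^K≤ = begin
        S ^ K                   ≤⟨ ^-monoˡ-≤ (fromℕ-nonNegative s) (≤-trans s≤Cnᵅ
                                     (*-monoʳ-≤ (<⇒≤ (^ᴿ-positive (1≤fromℕ 0<n) α)) C≤A)) K ⟩
        (A * N ^ᴿ α) ^ K        ≈⟨ ^-distrib-* A (N ^ᴿ α) K ⟩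
        A ^ K * (N ^ᴿ α) ^ K    ≤⟨ *-monoˡ-≤ (^-nonNegative 0≤A K) (begin
          (N ^ᴿ α) ^ K            ≈⟨ *-identityʳ _ ⟨
          (N ^ᴿ α) ^ K * N ^ 0    ≤⟨ ^ᴿ-upper (1≤fromℕ 0<n) K 0 c 0<K
                                       (≤-trans (≤-reflexive (+-identityʳ _)) (proj₁ (proj₂ cBound))) ⟩
          N ^ c                   ∎) ⟩
        A ^ K * N ^ c           ∎
      -- From j ≤ K β + 1 ≤ 2 K comes the factor A * A of the constant.
      A^j≤ : (A ^ j) ^ K ≤ ((A * A) ^ K) ^ K
      A^j≤ = ^-monoˡ-≤ (^-nonNegative 0≤A j) (begin
        A ^ j          ≤⟨ ^-monoʳ-≤ 1≤A j≤K+K ⟩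
        A ^ (K ℕ.+ K)  ≈⟨ ^-homo-* A K K ⟩
        A ^ K * A ^ K  ≈⟨ ^-distrib-* A A K ⟨
        (A * A) ^ K    ∎) K
        where
        j≤K+K : j ℕ.≤ K ℕ.+ K
        j≤K+K = fromℕ-cancel-≤ (begin
          fromℕ j            ≤⟨ proj₂ (proj₂ jBound) ⟩
          fromℕ K * β + 1#   ≤⟨ +-mono-≤ (*-monoˡ-≤ 0≤K β≤1) 1≤K ⟩
          fromℕ K * 1# + fromℕ K ≈⟨ +-congʳ (*-identityʳ _) ⟩
          fromℕ K + fromℕ K  ≈⟨ fromℕ-+ K K ⟨
          fromℕ (K ℕ.+ K)    ∎)
      cj≤ : c ℕ.* j ℕ.≤ K ℕ.* K ℕ.+ J ℕ.* K
      cj≤ = fromℕ-cancel-≤ (begin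
        fromℕ (c ℕ.* j)
          ≈⟨ fromℕ-* c j ⟩
        fromℕ c * fromℕ j
          ≤⟨ *-mono-≤ (fromℕ-nonNegative c) (+-nonNegative (*-nonNegative 0≤K (<⇒≤ 0<β)) 0≤1)
               (proj₂ (proj₂ cBound)) (proj₂ (proj₂ jBound)) ⟩
        (fromℕ K * α + 1#) * (fromℕ K * β + 1#)
          ≈⟨ solve 3 (λ K a b → (K :* a :+ con 1) :* (K :* b :+ con 1)
               := (a :* b) :* (K :* K) :+ ((a :+ b) :* K :+ con 1)) refl (fromℕ K) α β ⟩
        α * β * (fromℕ K * fromℕ K) + ((α + β) * fromℕ K + 1#)
          ≤⟨ +-mono-≤ (≤-reflexive (trans (*-congʳ (x*x⁻¹≈1 0<α)) (*-identityˡ _)))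
               (+-monoʳ-≤ _ (≤-trans 1≤K (≤-reflexive (sym (*-identityˡ _))))) ⟩
        fromℕ K * fromℕ K + ((α + β) * fromℕ K + 1# * fromℕ K)
          ≈⟨ +-congˡ (distribʳ _ _ _) ⟨
        fromℕ K * fromℕ K + (α + β + 1#) * fromℕ K
          ≤⟨ +-monoʳ-≤ _ (*-monoʳ-≤ 0≤K α+β+1≤J) ⟩
        fromℕ K * fromℕ K + fromℕ J * fromℕ K
          ≈⟨ trans (fromℕ-+ (K ℕ.* K) (J ℕ.* K)) (+-cong (fromℕ-* K K) (fromℕ-* J K)) ⟨
        fromℕ (K ℕ.* K ℕ.+ J ℕ.* K) ∎)
      N^cj≤ : N ^ (c ℕ.* j) ≤ (N ^ K) ^ K * (2# ^ K) ^ K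
      N^cj≤ = begin
        N ^ (c ℕ.* j)                   ≤⟨ ^-monoʳ-≤ (1≤fromℕ 0<n) cj≤ ⟩
        N ^ (K ℕ.* K ℕ.+ J ℕ.* K)       ≈⟨ ^-homo-* N (K ℕ.* K) (J ℕ.* K) ⟩
        N ^ (K ℕ.* K) * N ^ (J ℕ.* K)   ≈⟨ *-cong (^-assocʳ N K K) (^-assocʳ N J K) ⟨
        (N ^ K) ^ K * (N ^ J) ^ K       ≤⟨ *-monoˡ-≤ (^-nonNegative (^-nonNegative 0≤N K) K)
                                             (^-monoˡ-≤ (^-nonNegative 0≤N J) (begin
          N ^ J                           ≤⟨ ^-monoˡ-≤ 0≤N (fromℕ≤2^ n) J ⟩
          (2# ^ n) ^ J                    ≈⟨ ^-assocʳ 2# n J ⟩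
          2# ^ K                          ∎) K) ⟩
        (N ^ K) ^ K * (2# ^ K) ^ K      ∎

  16# : Carrier
  16# = 2# ^ 4

  16#-nonNegative : 0# ≤ 16#
  16#-nonNegative = ^-nonNegative (fromℕ-nonNegative 2) 4

  -- All exponents get the denominator `p`: β is rounded down to e / p for `h p` and up to (e + 1) /
  -- p for the power of n. Replacing n by 2 p costs 2 ^ c with c ≤ 3 p, and the one factor p left by
  -- rounding is at most 2 ^ p; together this is 16 ^ p.
  power*h≤16p : ∀ {n p} → 0 ℕ.< n → 0 ℕ.< p → n ℕ.≤ 2 ℕ.* p →
                fromℕ n ^ᴿ (1# + β) * h p ≤ 16# * fromℕ p
  power*h≤16p {n} {p} 0<n 0<p n≤2p =
    ^-cancelʳ-≤ (*-nonNegative 16#-nonNegative 0≤P) 0<p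
      (*-cancelʳ-≤ (^-positive (fromℕ-positive 0<p) e) (begin
        (G * h p) ^ p * P ^ e
          ≈⟨ trans (*-congʳ (^-distrib-* G (h p) p)) (*-assoc _ _ _) ⟩
        G ^ p * (h p ^ p * P ^ e)
          ≤⟨ *-mono-≤ (^-nonNegative (<⇒≤ (^ᴿ-positive (1≤fromℕ 0<n) _)) p) 0≤1 G^p≤
               (^ᴿ-upper (1≤fromℕ 0<p) p e 0 0<p (-β-upper (≤-trans e≤pβ (≤-reflexive (sym (+-identityˡ _)))))) ⟩
        N ^ c * 1#
          ≈⟨ *-identityʳ _ ⟩
        N ^ c
          ≤⟨ ^-monoˡ-≤ (fromℕ-nonNegative n) (≤-trans (fromℕ-mono-≤ n≤2p) (≤-reflexive (fromℕ-* 2 p))) c ⟩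
        (2# * P) ^ c
          ≈⟨ trans (^-distrib-* 2# P c) (*-congˡ (trans (^-homo-* P (p ℕ.+ 1) e) (*-congʳ (^-homo-* P p 1)))) ⟩
        2# ^ c * (P ^ p * P ^ 1 * P ^ e)
          ≤⟨ *-mono-≤ (^-nonNegative 0≤2 c)
               (*-nonNegative (*-nonNegative (^-nonNegative 0≤P p) (^-nonNegative 0≤2 p)) (^-nonNegative 0≤P e))
               (^-monoʳ-≤ (1≤fromℕ {2} (s≤s z≤n)) c≤3p)
               (*-monoʳ-≤ (^-nonNegative 0≤P e) (*-monoˡ-≤ (^-nonNegative 0≤P p)
                 (≤-trans (≤-reflexive (*-identityʳ P)) (fromℕ≤2^ p)))) ⟩
        2# ^ (3 ℕ.* p) * (P ^ p * 2# ^ p * P ^ e)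
          ≈⟨ solve 4 (λ a b c d → a :* (b :* c :* d) := (a :* c) :* b :* d) refl _ _ _ _ ⟩
        2# ^ (3 ℕ.* p) * 2# ^ p * P ^ p * P ^ e
          ≈⟨ *-congʳ (*-congʳ (^-homo-* 2# (3 ℕ.* p) p)) ⟨
        2# ^ (3 ℕ.* p ℕ.+ p) * P ^ p * P ^ e
          ≡⟨ ≡.cong (λ m → 2# ^ m * P ^ p * P ^ e) (ℕ.+-comm (3 ℕ.* p) p) ⟩
        2# ^ (4 ℕ.* p) * P ^ p * P ^ e
          ≈⟨ *-congʳ (trans (^-distrib-* 16# P p) (*-congʳ (^-assocʳ 2# 4 p))) ⟨
        (16# * P) ^ p * P ^ e ∎))
    where
    N = fromℕ n
    P = fromℕ p
    G = N ^ᴿ (1# + β)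
    0≤P = fromℕ-nonNegative p
    0≤2 = fromℕ-nonNegative 2
    eBound = floor (*-nonNegative 0≤P (<⇒≤ 0<β))
    e = proj₁ eBound
    e≤pβ = proj₁ (proj₂ eBound)
    c = p ℕ.+ 1 ℕ.+ e
    G^p≤ : G ^ p ≤ N ^ c
    G^p≤ = begin
      G ^ p             ≈⟨ *-identityʳ _ ⟨
      G ^ p * N ^ 0     ≤⟨ ^ᴿ-upper (1≤fromℕ 0<n) p 0 c 0<p (begin
        P * (1# + β) + 0#   ≈⟨ solve 2 (λ p b → p :* (con 1 :+ b) :+ con 0 := p :+ p :* b) refl P β ⟩
        P + P * β           ≤⟨ +-monoʳ-≤ P (proj₂ (proj₂ eBound)) ⟩
        P + fromℕ (suc e)   ≈⟨ fromℕ-+ p (suc e) ⟨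
        fromℕ (p ℕ.+ suc e) ≡⟨ ≡.cong fromℕ (≡.sym (ℕ.+-assoc p 1 e)) ⟩
        fromℕ c             ∎) ⟩
      N ^ c             ∎
    e≤p : e ℕ.≤ p
    e≤p = fromℕ-cancel-≤ (begin
      fromℕ e ≤⟨ e≤pβ ⟩
      P * β   ≤⟨ *-monoˡ-≤ 0≤P β≤1 ⟩
      P * 1#  ≈⟨ *-identityʳ P ⟩
      P       ∎)
    c≤3p : c ℕ.≤ 3 ℕ.* p
    c≤3p = ℕ.≤-trans (ℕ.+-mono-≤ (ℕ.+-monoʳ-≤ p 0<p) e≤p)
      (ℕ.≤-reflexive (≡.trans (ℕ.+-assoc p p p) (≡.cong (λ m → p ℕ.+ (p ℕ.+ m)) (≡.sym (ℕ.+-identityʳ p)))))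

-- Finite sums and their limits.

module Sum (em : ExcludedMiddle 0ℓ) (R : CompleteOrderedField) where

  open OrderedField em R
  open Classical em R

  ∑ : ℕ → (ℕ → Carrier) → Carrier
  ∑ zero    f = 0#
  ∑ (suc n) f = ∑ n f + f n

  -- An Iverson bracket times `x`: sums over arbitrary sets keep an initial segment as their index
  -- range and can then be interchanged.
  when : Set → Carrier → Carrier
  when A x = if does (em {A}) then x else 0#

  when-true : ∀ {A x} → A → when A x ≈ x
  when-true {A} a with em {A}
  ... | yes _ = refl
  ... | no ¬a = contradiction a ¬a

  when-false : ∀ {A x} → ¬ A → when A x ≈ 0#
  when-false {A} ¬a with em {A}
  ... | yes a = contradiction a ¬a
  ... | no _  = refl

  when-≤ : ∀ {A x y} → 0# ≤ y → (A → x ≤ y) → when A x ≤ y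
  when-≤ {A} 0≤y x≤y with em {A}
  ... | yes a = x≤y a
  ... | no _  = 0≤y

  when-nonNegative : ∀ {A x} → (A → 0# ≤ x) → 0# ≤ when A x
  when-nonNegative {A} 0≤x with em {A}
  ... | yes a = 0≤x a
  ... | no _  = ≤-refl

  ∑-cong : ∀ {f g} n → (∀ i → f i ≈ g i) → ∑ n f ≈ ∑ n g
  ∑-cong zero    f≈g = refl
  ∑-cong (suc n) f≈g = +-cong (∑-cong n f≈g) (f≈g n)

  ∑-mono-≤ : ∀ {f g} n → (∀ {i} → i ℕ.< n → f i ≤ g i) → ∑ n f ≤ ∑ n g
  ∑-mono-≤ zero    f≤g = ≤-refl
  ∑-mono-≤ (suc n) f≤g = +-mono-≤ (∑-mono-≤ n (f≤g ∘ ℕ.m<n⇒m<1+n)) (f≤g ℕ.≤-refl)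

  ∑-const : ∀ n c → ∑ n (λ _ → c) ≈ fromℕ n * c
  ∑-const zero    c = sym (zeroˡ c)
  ∑-const (suc n) c = begin-equality
    ∑ n (λ _ → c) + c  ≈⟨ +-congʳ (∑-const n c) ⟩
    fromℕ n * c + c    ≈⟨ solve 2 (λ n c → n :* c :+ c := (con 1 :+ n) :* c) refl (fromℕ n) c ⟩
    fromℕ (suc n) * c  ∎

  ∑-nonNegative : ∀ {f} n → (∀ i → 0# ≤ f i) → 0# ≤ ∑ n f
  ∑-nonNegative zero    0≤f = ≤-refl
  ∑-nonNegative (suc n) 0≤f = +-nonNegative (∑-nonNegative n 0≤f) (0≤f n)

  ∑-nonPositive : ∀ {f} n → (∀ {i} → i ℕ.< n → f i ≤ 0#) → ∑ n f ≤ 0#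
  ∑-nonPositive {f} n f≤0 = begin
    ∑ n f           ≤⟨ ∑-mono-≤ n f≤0 ⟩
    ∑ n (λ _ → 0#)  ≈⟨ trans (∑-const n 0#) (zeroʳ _) ⟩
    0#              ∎

  ∑-+ : ∀ n f g → ∑ n (λ i → f i + g i) ≈ ∑ n f + ∑ n g
  ∑-+ zero    f g = sym (+-identityˡ 0#)
  ∑-+ (suc n) f g = begin-equality
    ∑ n (λ i → f i + g i) + (f n + g n) ≈⟨ +-congʳ (∑-+ n f g) ⟩
    ∑ n f + ∑ n g + (f n + g n)         ≈⟨ solve 4 (λ a b c d → a :+ b :+ (c :+ d) := a :+ c :+ (b :+ d)) refl _ _ _ _ ⟩
    ∑ n f + f n + (∑ n g + g n)         ∎

  ∑-*ˡ : ∀ n c f → ∑ n (λ i → c * f i) ≈ c * ∑ n f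
  ∑-*ˡ zero    c f = sym (zeroʳ c)
  ∑-*ˡ (suc n) c f = trans (+-congʳ (∑-*ˡ n c f)) (sym (distribˡ c _ _))

  ∑-*ʳ : ∀ n c f → ∑ n (λ i → f i * c) ≈ ∑ n f * c
  ∑-*ʳ n c f = trans (∑-cong n λ i → *-comm (f i) c) (trans (∑-*ˡ n c f) (*-comm c _))

  ∑-swap : ∀ m n (f : ℕ → ℕ → Carrier) → ∑ m (λ i → ∑ n (f i)) ≈ ∑ n (λ j → ∑ m (λ i → f i j))
  ∑-swap zero    n f = sym (trans (∑-const n 0#) (zeroʳ _))
  ∑-swap (suc m) n f = trans (+-congʳ (∑-swap m n f)) (sym (∑-+ n _ (f m)))

  ∑-split : ∀ m n f → ∑ (m ℕ.+ n) f ≈ ∑ m f + ∑ n (λ i → f (m ℕ.+ i))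
  ∑-split m zero f = begin-equality
    ∑ (m ℕ.+ 0) f ≡⟨ ≡.cong (λ k → ∑ k f) (ℕ.+-identityʳ m) ⟩
    ∑ m f         ≈⟨ +-identityʳ _ ⟨
    ∑ m f + 0#    ∎
  ∑-split m (suc n) f = begin-equality
    ∑ (m ℕ.+ suc n) f                                  ≡⟨ ≡.cong (λ k → ∑ k f) (ℕ.+-suc m n) ⟩
    ∑ (m ℕ.+ n) f + f (m ℕ.+ n)                        ≈⟨ +-congʳ (∑-split m n f) ⟩
    ∑ m f + ∑ n (λ i → f (m ℕ.+ i)) + f (m ℕ.+ n)      ≈⟨ +-assoc _ _ _ ⟩
    ∑ m f + (∑ n (λ i → f (m ℕ.+ i)) + f (m ℕ.+ n))    ∎

  ∑-monoˡ-≤ : ∀ {f m n} → (∀ i → 0# ≤ f i) → m ℕ.≤ n → ∑ m f ≤ ∑ n f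
  ∑-monoˡ-≤ {f} {m} {n} 0≤f m≤n = begin
    ∑ m f                                      ≤⟨ x≤x+y _ (∑-nonNegative (n ℕ.∸ m) λ i → 0≤f (m ℕ.+ i)) ⟩
    ∑ m f + ∑ (n ℕ.∸ m) (λ i → f (m ℕ.+ i))    ≈⟨ ∑-split m (n ℕ.∸ m) f ⟨
    ∑ (m ℕ.+ (n ℕ.∸ m)) f                      ≡⟨ ≡.cong (λ k → ∑ k f) (ℕ.m+[n∸m]≡n m≤n) ⟩
    ∑ n f                                      ∎

  ∑-tail-≤ : ∀ {f} m n → (∀ i → 0# ≤ f i) → ∑ n (λ i → f (m ℕ.+ i)) ≤ ∑ (m ℕ.+ n) f
  ∑-tail-≤ {f} m n 0≤f = ≤-trans (y≤x+y _ (∑-nonNegative m 0≤f)) (≤-reflexive (sym (∑-split m n f)))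

  term≤∑ : ∀ {f i n} → (∀ i → 0# ≤ f i) → i ℕ.< n → f i ≤ ∑ n f
  term≤∑ {f} {i} 0≤f i<n = ≤-trans (y≤x+y (f i) (∑-nonNegative i 0≤f)) (∑-monoˡ-≤ 0≤f i<n)

  ∑-truncate : ∀ {f} m n → (∀ i → 0# ≤ f i) → (∀ {i} → m ℕ.≤ i → f i ≤ 0#) → ∑ n f ≤ ∑ m f
  ∑-truncate {f} m n 0≤f f≤0 = begin
    ∑ n f                            ≤⟨ ∑-monoˡ-≤ 0≤f (ℕ.m≤n+m n m) ⟩
    ∑ (m ℕ.+ n) f                    ≈⟨ ∑-split m n f ⟩
    ∑ m f + ∑ n (λ i → f (m ℕ.+ i))  ≤⟨ +-monoʳ-≤ _ (∑-nonPositive n λ {i} _ → f≤0 (ℕ.m≤m+n m i)) ⟩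
    ∑ m f + 0#                       ≈⟨ +-identityʳ _ ⟩
    ∑ m f                            ∎

  -- An inequality, because `c` may lie outside the range of summation.
  ∑-single : ∀ {c x} N → 0# ≤ x → ∑ N (λ n → when (n ≡ c) x) ≤ x
  ∑-single zero 0≤x = 0≤x
  ∑-single {c} {x} (suc N) 0≤x = last em
    where
    last : Dec (N ≡ c) → ∑ N (λ n → when (n ≡ c) x) + when (N ≡ c) x ≤ x
    last (yes N≡c) = begin
      ∑ N (λ n → when (n ≡ c) x) + when (N ≡ c) x
        ≤⟨ +-mono-≤ (∑-nonPositive N λ i<N → ≤-reflexive (when-false λ i≡c →
             ℕ.<-irrefl (≡.trans i≡c (≡.sym N≡c)) i<N)) (≤-reflexive (when-true N≡c)) ⟩
      0# + x ≈⟨ +-identityˡ x ⟩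
      x      ∎
    last (no N≢c) = begin
      ∑ N (λ n → when (n ≡ c) x) + when (N ≡ c) x
        ≤⟨ +-mono-≤ (∑-single N 0≤x) (≤-reflexive (when-false N≢c)) ⟩
      x + 0# ≈⟨ +-identityʳ x ⟩
      x      ∎

  -- The inner double sum is a truncated Dirichlet convolution. After the interchange each pair (p ,
  -- m) meets at most one n = p m, and what remains factors into two sums; pairs with p m ≥ N only
  -- enlarge the right-hand side.
  ∑-convolution : ∀ {f e w : ℕ → Carrier} N → (∀ n → 0# ≤ f n) → (∀ p → 0# ≤ w p) →
    (∀ {n} → n ℕ.< N → f n ≤ e n + ∑ N (λ p → ∑ N (λ m → when (n ≡ p ℕ.* m) (w p * f m)))) →
    ∑ N f ≤ ∑ N e + ∑ N w * ∑ N f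
  ∑-convolution {f} {e} {w} N 0≤f 0≤w f≤ = begin
    ∑ N f
      ≤⟨ ∑-mono-≤ N f≤ ⟩
    ∑ N (λ n → e n + ∑ N (λ p → ∑ N (λ m → when (n ≡ p ℕ.* m) (w p * f m))))
      ≈⟨ ∑-+ N e _ ⟩
    ∑ N e + ∑ N (λ n → ∑ N (λ p → ∑ N (λ m → when (n ≡ p ℕ.* m) (w p * f m))))
      ≈⟨ +-congˡ (trans (∑-swap N N _) (∑-cong N λ p → ∑-swap N N _)) ⟩
    ∑ N e + ∑ N (λ p → ∑ N (λ m → ∑ N (λ n → when (n ≡ p ℕ.* m) (w p * f m))))
      ≤⟨ +-monoʳ-≤ _ (∑-mono-≤ N λ {p} _ → ∑-mono-≤ N λ {m} _ →
           ∑-single N (*-nonNegative (0≤w p) (0≤f m))) ⟩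
    ∑ N e + ∑ N (λ p → ∑ N (λ m → w p * f m))
      ≈⟨ +-congˡ (trans (∑-cong N λ p → ∑-*ˡ N (w p) f) (∑-*ʳ N _ w)) ⟩
    ∑ N e + ∑ N w * ∑ N f ∎

  convolution-term : ∀ {f w : ℕ → Carrier} {N n p m} → (∀ n → 0# ≤ f n) → (∀ p → 0# ≤ w p) →
    p ℕ.< N → m ℕ.< N → n ≡ p ℕ.* m →
    w p * f m ≤ ∑ N (λ p → ∑ N (λ m → when (n ≡ p ℕ.* m) (w p * f m)))
  convolution-term {f} {w} {N} {n} {p} {m} 0≤f 0≤w p<N m<N n≡pm = begin
    w p * f m                          ≈⟨ when-true n≡pm ⟨
    when (n ≡ p ℕ.* m) (w p * f m)     ≤⟨ term≤∑ (λ m → when-nonNegative λ _ → 0≤wf p m) m<N ⟩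
    ∑ N (λ m → when (n ≡ p ℕ.* m) (w p * f m))
      ≤⟨ term≤∑ (λ p → ∑-nonNegative N λ m → when-nonNegative λ _ → 0≤wf p m) p<N ⟩
    ∑ N (λ p → ∑ N (λ m → when (n ≡ p ℕ.* m) (w p * f m))) ∎
    where
    0≤wf : ∀ p m → 0# ≤ w p * f m
    0≤wf p m = *-nonNegative (0≤w p) (0≤f m)

  Bounded : (ℕ → Carrier) → Set
  Bounded u = ∃ λ B → ∀ n → u n ≤ B

  unbounded⇒tendsTo∞ : ∀ {u} → (∀ {m n} → m ℕ.≤ n → u m ≤ u n) → ¬ Bounded u → TendsTo∞ u
  unbounded⇒tendsTo∞ {u} mono unbounded c with em {∃ λ m → c ≤ u m}
  ... | yes (m , c≤uₘ) = m , λ n m≤n → ≤-trans c≤uₘ (mono m≤n)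
  ... | no ∄m = contradiction (c , λ n → <⇒≤ (≰⇒> λ c≤uₙ → ∄m (n , c≤uₙ))) unbounded

  -- Some partial sum comes within ε of the supremum `u`, since otherwise u - ε would be a smaller
  -- upper bound; everything after that partial sum adds at most ε.
  smallTails : ∀ {f ε} → (∀ i → 0# ≤ f i) → Bounded (λ n → ∑ n f) → 0# < ε →
               ∃ λ m → ∀ n → ∑ n (λ i → f (m ℕ.+ i)) ≤ ε
  smallTails {f} {ε} 0≤f (B , ∑f≤B) 0<ε = near em
    where
    Value : Pred Carrier 0ℓ
    Value x = ∃ λ n → ∑ n f ≈ x
    lub : ∃ (LeastUpperBound Value)
    lub = complete Value (0# , 0 , refl) (B , λ x (n , ∑≈x) → ≤-trans (≤-reflexive (sym ∑≈x)) (∑f≤B n))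
    u : Carrier
    u = proj₁ lub
    near : Dec (∃ λ m → u ≤ ∑ m f + ε) → ∃ λ m → ∀ n → ∑ n (λ i → f (m ℕ.+ i)) ≤ ε
    near (yes (m , u≤)) = m , λ n → +-cancelˡ-≤ (∑ m f) (begin
      ∑ m f + ∑ n (λ i → f (m ℕ.+ i)) ≈⟨ ∑-split m n f ⟨
      ∑ (m ℕ.+ n) f                   ≤⟨ proj₁ (proj₂ lub) _ (m ℕ.+ n , refl) ⟩
      u                               ≤⟨ u≤ ⟩
      ∑ m f + ε                       ∎)
    near (no ∄m) = contradiction (proj₂ (proj₂ lub) (u + - ε) λ x (n , ∑≈x) → +-cancelˡ-≤ ε (begin
      ε + x          ≈⟨ +-comm ε x ⟩
      x + ε          ≈⟨ +-congʳ ∑≈x ⟨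
      ∑ n f + ε      ≤⟨ <⇒≤ (≰⇒> λ u≤ → ∄m (n , u≤)) ⟩
      u              ≈⟨ x+[y-x]≈y ε u ⟨
      ε + (u + - ε)  ∎))
      (<⇒≱ (begin-strict
        u + - ε        <⟨ x<x+y _ 0<ε ⟩
        u + - ε + ε    ≈⟨ +-comm _ ε ⟩
        ε + (u + - ε)  ≈⟨ x+[y-x]≈y ε u ⟩
        u              ∎))

  -- Divergence of the harmonic series.

  harmonic : ℕ → Carrier
  harmonic n = ∑ n (λ i → (fromℕ (suc i)) ⁻¹)

  -- Passing from n to 2 n adds n terms of size at least 1 / (2 n), a gain of 1/2; the factor `2#`
  -- avoids the fraction.
  harmonic-doubling : ∀ k → ∃ λ n → 0 ℕ.< n × fromℕ k ≤ 2# * harmonic n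
  harmonic-doubling zero = 1 , s≤s z≤n , *-nonNegative (fromℕ-nonNegative 2)
    (∑-nonNegative 1 λ i → <⇒≤ (⁻¹-positive (fromℕ-positive {suc i} (s≤s z≤n))))
  harmonic-doubling (suc k) =
    let n , 0<n , k≤2Hₙ = harmonic-doubling k
        0<n+n = ℕ.<-≤-trans 0<n (ℕ.m≤m+n n n)
    in n ℕ.+ n , 0<n+n , (begin
      1# + fromℕ k
        ≈⟨ +-congʳ (x*x⁻¹≈1 (fromℕ-positive 0<n+n)) ⟨
      fromℕ (n ℕ.+ n) * fromℕ (n ℕ.+ n) ⁻¹ + fromℕ k
        ≤⟨ +-mono-≤ (≤-reflexive (begin-equality
          fromℕ (n ℕ.+ n) * fromℕ (n ℕ.+ n) ⁻¹
            ≈⟨ *-congʳ (trans (fromℕ-+ n n) (sym (2#-double (fromℕ n)))) ⟩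
          2# * fromℕ n * fromℕ (n ℕ.+ n) ⁻¹
            ≈⟨ *-assoc _ _ _ ⟩
          2# * (fromℕ n * fromℕ (n ℕ.+ n) ⁻¹)
            ≈⟨ *-congˡ (∑-const n _) ⟨
          2# * ∑ n (λ _ → fromℕ (n ℕ.+ n) ⁻¹) ∎)) k≤2Hₙ ⟩
      2# * ∑ n (λ _ → fromℕ (n ℕ.+ n) ⁻¹) + 2# * harmonic n
        ≤⟨ +-mono-≤ (*-monoˡ-≤ (fromℕ-nonNegative 2) (∑-mono-≤ n λ {i} i<n →
             ⁻¹-anti-≤ (fromℕ-positive {suc (n ℕ.+ i)} (s≤s z≤n)) (fromℕ-mono-≤ (ℕ.+-monoʳ-< n i<n)))) ≤-refl ⟩
      2# * ∑ n (λ i → fromℕ (suc (n ℕ.+ i)) ⁻¹) + 2# * harmonic n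
        ≈⟨ trans (+-comm _ _) (sym (distribˡ 2# _ _)) ⟩
      2# * (harmonic n + ∑ n (λ i → fromℕ (suc (n ℕ.+ i)) ⁻¹))
        ≈⟨ *-congˡ (∑-split n n _) ⟨
      2# * harmonic (n ℕ.+ n) ∎)

  harmonic-unbounded : ¬ Bounded harmonic
  harmonic-unbounded (B , H≤B) =
    let k , 2B≤k = archimedean (2# * B)
        n , _ , k+1≤2H = harmonic-doubling (suc k)
    in <⇒≱ (begin-strict
      fromℕ k         <⟨ x<x+y _ 0<1 ⟩
      fromℕ k + 1#    ≈⟨ +-comm _ _ ⟩
      fromℕ (suc k)   ∎) (begin
      fromℕ (suc k)   ≤⟨ k+1≤2H ⟩
      2# * harmonic n ≤⟨ *-monoˡ-≤ (fromℕ-nonNegative 2) (H≤B n) ⟩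
      2# * B          ≤⟨ 2B≤k ⟩
      fromℕ k         ∎)

  -- Sums over lists as indexed sums.

  sumOver-++ : ∀ xs ys f → sumOver (xs ++ ys) f ≈ sumOver xs f + sumOver ys f
  sumOver-++ []       ys f = sym (+-identityˡ _)
  sumOver-++ (x ∷ xs) ys f = trans (+-congˡ (sumOver-++ xs ys f)) (sym (+-assoc _ _ _))

  sumOver-filter : ∀ (P : Pred ℕ 0ℓ) n f →
    sumOver (filter (λ p → em {P p}) (upTo n)) f ≈ ∑ n (λ p → when (P p) (f p))
  sumOver-filter P zero    f = refl
  sumOver-filter P (suc n) f = begin-equality
    sumOver (filter P? (upTo (suc n))) f
      ≡⟨ ≡.cong (λ xs → sumOver (filter P? xs) f) (≡.sym (upTo-∷ʳ n)) ⟩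
    sumOver (filter P? (upTo n ∷ʳ n)) f
      ≡⟨ ≡.cong (λ xs → sumOver xs f) (filter-++ P? (upTo n) (n ∷ [])) ⟩
    sumOver (filter P? (upTo n) ++ filter P? (n ∷ [])) f
      ≈⟨ sumOver-++ (filter P? (upTo n)) (filter P? (n ∷ [])) f ⟩
    sumOver (filter P? (upTo n)) f + sumOver (filter P? (n ∷ [])) f
      ≈⟨ +-cong (sumOver-filter P n f) last ⟩
    ∑ n (λ p → when (P p) (f p)) + when (P n) (f n) ∎
    where
    P? = λ p → em {P p}
    last : sumOver (filter P? (n ∷ [])) f ≈ when (P n) (f n)
    last with em {P n}
    ... | yes _ = +-identityʳ (f n)
    ... | no _  = refl

  fromℕ-length : ∀ (xs : List ℕ) → fromℕ (length xs) ≈ sumOver xs (λ _ → 1#)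
  fromℕ-length []       = refl
  fromℕ-length (x ∷ xs) = +-congˡ (fromℕ-length xs)

  partialSum≈∑ : ∀ f n → partialSum f n ≈ ∑ n (f ∘ suc)
  partialSum≈∑ f zero    = refl
  partialSum≈∑ f (suc n) = begin-equality
    sumOver (map suc (upTo (suc n))) f
      ≡⟨ ≡.cong (λ xs → sumOver (map suc xs) f) (≡.sym (upTo-∷ʳ n)) ⟩
    sumOver (map suc (upTo n ∷ʳ n)) f
      ≡⟨ ≡.cong (λ xs → sumOver xs f) (map-++ suc (upTo n) (n ∷ [])) ⟩
    sumOver (map suc (upTo n) ++ suc n ∷ []) f
      ≈⟨ sumOver-++ (map suc (upTo n)) (suc n ∷ []) f ⟩
    partialSum f n + (f (suc n) + 0#)
      ≈⟨ +-cong (partialSum≈∑ f n) (+-identityʳ _) ⟩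
    ∑ n (f ∘ suc) + f (suc n) ∎

-- Prime divisors.

prime⇒1< : ∀ {p} → Prime p → 1 ℕ.< p
prime⇒1< {p} pp = ℕ.nonTrivial⇒n>1 p {{prime⇒nonTrivial pp}}

prime⇒0< : ∀ {p} → Prime p → 0 ℕ.< p
prime⇒0< pp = ℕ.<-trans (s≤s z≤n) (prime⇒1< pp)

primeDivisor : ∀ {n} → 1 ℕ.< n → ∃ λ p → Prime p × p ∣ n
primeDivisor {suc n} 1<n = go (PrimeFactorisation.factors f) (PrimeFactorisation.isFactorisation f)
                              (PrimeFactorisation.factorsPrime f)
  where
  f = factorise (suc n)
  go : ∀ ps → suc n ≡ product ps → All Prime ps → ∃ λ p → Prime p × p ∣ suc n
  go []       n≡1 []       = contradiction (≡.sym n≡1) (ℕ.<⇒≢ 1<n)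
  go (p ∷ ps) n≡  (pp ∷ _) = p , pp , divides (product ps) (≡.trans n≡ (ℕ.*-comm p (product ps)))

positiveFactors : ∀ m n → 0 ℕ.< m ℕ.* n → 0 ℕ.< m × 0 ℕ.< n
positiveFactors (suc m) (suc n) _    = s≤s z≤n , s≤s z≤n
positiveFactors (suc m) zero    0<mn = contradiction (≡.subst (0 ℕ.<_) (ℕ.*-zeroʳ m) 0<mn) λ ()

-- Sums over the integers built from a set of primes.

module Sieve (em : ExcludedMiddle 0ℓ) (R : CompleteOrderedField)
  (α : CompleteOrderedField.Carrier R)
  (1≤α : CompleteOrderedField._≤_ R (CompleteOrderedField.1# R) α)
  (P : Pred ℕ 0ℓ) (P⇒prime : ∀ {p} → P p → Prime p) where

  open OrderedField em R
  open Exponent em R α 1≤α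
  open Sum em R

  -- The multiplicative monoid generated by the primes of `P` from `M` on; 1 belongs to it
  -- vacuously.
  Admissible : ℕ → Pred ℕ 0ℓ
  Admissible M n = 0 ℕ.< n × (∀ q → Prime q → q ∣ n → P q × M ℕ.≤ q)

  admissible-divisor : ∀ {M m n} → m ∣ n → 0 ℕ.< m → Admissible M n → Admissible M m
  admissible-divisor m∣n 0<m (_ , divisors) = 0<m , λ q pq q∣m → divisors q pq (∣-trans q∣m m∣n)

  term : ℕ → ℕ → Carrier
  term M n = when (Admissible M n) (h n)

  T : ℕ → ℕ → Carrier
  T M N = ∑ N (term M)

  term-nonNegative : ∀ M n → 0# ≤ term M n
  term-nonNegative M n = when-nonNegative (<⇒≤ ∘ h-positive ∘ proj₁)

  T-nonNegative : ∀ M N → 0# ≤ T M N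
  T-nonNegative M N = ∑-nonNegative N (term-nonNegative M)

  -- The weight `w` is left open because it has two uses: `P-weight` cut off below `M`, and `h M`
  -- concentrated at `M`.
  h-factor : ∀ {M N n p} {w : ℕ → Carrier} → (∀ p → 0# ≤ w p) → Admissible M n → n ℕ.< N →
             Prime p → p ∣ n → h p ≤ w p →
             h n ≤ ∑ N (λ p → ∑ N (λ m → when (n ≡ p ℕ.* m) (w p * term M m)))
  h-factor {M} {N} {n} {p} {w} 0≤w adm n<N pp p∣n h≤w = begin
    h n              ≡⟨ ≡.cong h n≡pm ⟩
    h (p ℕ.* m)      ≤⟨ h-submultiplicative 0<p 0<m ⟩
    h p * h m        ≤⟨ *-monoʳ-≤ (<⇒≤ (h-positive 0<m)) h≤w ⟩
    w p * h m        ≈⟨ *-congˡ (when-true (admissible-divisor m∣n 0<m adm)) ⟨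
    w p * term M m   ≤⟨ convolution-term (term-nonNegative M) 0≤w (ℕ.≤-<-trans p≤n n<N) (ℕ.≤-<-trans m≤n n<N) n≡pm ⟩
    ∑ N (λ p → ∑ N (λ m → when (n ≡ p ℕ.* m) (w p * term M m))) ∎
    where
    m : ℕ
    m = quotient p∣n
    n≡pm : n ≡ p ℕ.* m
    n≡pm = m∣n⇒n≡m*quotient p∣n
    0<p : 0 ℕ.< p
    0<p = prime⇒0< pp
    0<m : 0 ℕ.< m
    0<m = proj₂ (positiveFactors p m (≡.subst (0 ℕ.<_) n≡pm (proj₁ adm)))
    m∣n : m ∣ n
    m∣n = quotient-∣ p∣n
    -- As divisors of the positive n, both p and m lie below `N`, so the pair occurs in the
    -- truncated double sum.
    p≤n : p ℕ.≤ n
    p≤n = ∣⇒≤ {{ℕ.>-nonZero (proj₁ adm)}} p∣n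
    m≤n : m ℕ.≤ n
    m≤n = ∣⇒≤ {{ℕ.>-nonZero (proj₁ adm)}} m∣n

  P-weight : ℕ → Carrier
  P-weight p = when (P p) (h p)

  P-weight-nonNegative : ∀ p → 0# ≤ P-weight p
  P-weight-nonNegative p = when-nonNegative (<⇒≤ ∘ h-positive ∘ prime⇒0< ∘ P⇒prime)

  -- The estimate is kept in the doubled form 2 T ≤ 2 + T; cancelling the finite T leaves the bound
  -- 2, uniformly in `N`.
  T-bounded-by-tail : ∀ {ε} M → 2# * ε ≤ 1# → (∀ N → ∑ N (λ i → P-weight (M ℕ.+ i)) ≤ ε) → Bounded (T M)
  T-bounded-by-tail {ε} M 2ε≤1 tail≤ε = 2# , λ N → +-cancelʳ-≤ (T M N) (begin
    T M N + T M N                   ≈⟨ 2#-double (T M N) ⟨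
    2# * T M N                      ≤⟨ *-monoˡ-≤ 0≤2 (∑-convolution N (term-nonNegative M) 0≤w (step N)) ⟩
    2# * (∑ N e + ∑ N w * T M N)    ≤⟨ *-monoˡ-≤ 0≤2 (+-mono-≤ (∑-single N 0≤1) (*-monoʳ-≤ (T-nonNegative M N) (∑w≤ε N))) ⟩
    2# * (1# + ε * T M N)           ≈⟨ solve 3 (λ a e t → a :* (con 1 :+ e :* t) := a :+ a :* e :* t) refl 2# ε (T M N) ⟩
    2# + 2# * ε * T M N             ≤⟨ +-monoʳ-≤ 2# (*-monoʳ-≤ (T-nonNegative M N) 2ε≤1) ⟩
    2# + 1# * T M N                 ≈⟨ +-congˡ (*-identityˡ _) ⟩
    2# + T M N                      ∎)
    where
    0≤2 : 0# ≤ 2#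
    0≤2 = fromℕ-nonNegative 2
    e w : ℕ → Carrier
    -- The integer 1 has no prime to extract and is accounted for separately.
    e n = when (n ≡ 1) 1#
    w p = when (M ℕ.≤ p) (P-weight p)
    0≤w : ∀ p → 0# ≤ w p
    0≤w p = when-nonNegative λ _ → P-weight-nonNegative p
    ∑w≤ε : ∀ N → ∑ N w ≤ ε
    ∑w≤ε N = begin
      ∑ N w                                   ≤⟨ ∑-monoˡ-≤ 0≤w (ℕ.m≤n+m N M) ⟩
      ∑ (M ℕ.+ N) w                           ≈⟨ ∑-split M N w ⟩
      ∑ M w + ∑ N (λ i → w (M ℕ.+ i))         ≤⟨ +-mono-≤
        (∑-nonPositive M λ p<M → ≤-reflexive (when-false (ℕ.<⇒≱ p<M)))
        (∑-mono-≤ N λ {i} _ → ≤-reflexive (when-true (ℕ.m≤m+n M i))) ⟩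
      0# + ∑ N (λ i → P-weight (M ℕ.+ i))     ≤⟨ +-monoʳ-≤ 0# (tail≤ε N) ⟩
      0# + ε                                  ≈⟨ +-identityˡ ε ⟩
      ε                                       ∎
    step : ∀ N {n} → n ℕ.< N →
           term M n ≤ e n + ∑ N (λ p → ∑ N (λ m → when (n ≡ p ℕ.* m) (w p * term M m)))
    step N {n} n<N = when-≤ (+-nonNegative 0≤e 0≤∑) (λ adm → cases adm (ℕ.m≤n⇒m<n∨m≡n (proj₁ adm)))
      where
      0≤e : 0# ≤ e n
      0≤e = when-nonNegative λ _ → 0≤1
      0≤∑ : 0# ≤ ∑ N (λ p → ∑ N (λ m → when (n ≡ p ℕ.* m) (w p * term M m)))
      0≤∑ = ∑-nonNegative N λ p → ∑-nonNegative N λ m → when-nonNegative λ _ →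
              *-nonNegative (0≤w p) (term-nonNegative M m)
      cases : Admissible M n → 1 ℕ.< n ⊎ 1 ≡ n →
              h n ≤ e n + ∑ N (λ p → ∑ N (λ m → when (n ≡ p ℕ.* m) (w p * term M m)))
      cases adm (inj₁ 1<n) =
        let p , pp , p∣n = primeDivisor 1<n
            Pp , M≤p     = proj₂ adm p pp p∣n
        in ≤-trans (h-factor 0≤w adm n<N pp p∣n
             (≤-reflexive (sym (trans (when-true M≤p) (when-true Pp))))) (y≤x+y _ 0≤e)
      cases adm (inj₂ 1≡n) = begin
        h n          ≤⟨ h≤1 (proj₁ adm) ⟩
        1#           ≈⟨ when-true (≡.sym 1≡n) ⟨
        e n          ≤⟨ x≤x+y (e n) 0≤∑ ⟩
        e n + _      ∎

  admissible-suc : ∀ {M n} → ¬ (P M × M ∣ n) → Admissible M n → Admissible (suc M) n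
  admissible-suc {M} {n} ∤ (0<n , divisors) = 0<n , λ q pq q∣n →
    let Pq , M≤q = divisors q pq q∣n in
    Pq , ℕ.≤∧≢⇒< M≤q λ M≡q → ∤ (≡.subst P (≡.sym M≡q) Pq , ≡.subst (_∣ n) (≡.sym M≡q) q∣n)

  -- A multiple of `M` gives up a single factor `M`, and its cofactor is still admissible for the
  -- same `M`. Hence `T M N` itself returns on the right with the factor `h M`, in place of a
  -- geometric series over the multiplicity of `M`.
  T-bounded-pred : ∀ M → Bounded (T (suc M)) → Bounded (T M)
  T-bounded-pred M (B , T≤B) = cases em
    where
    cases : Dec (P M) → Bounded (T M)
    cases (no ¬PM) = B , λ N → ≤-trans (∑-mono-≤ N λ {n} _ →
      when-≤ (term-nonNegative (suc M) n) λ adm →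
        ≤-reflexive (sym (when-true (admissible-suc (¬PM ∘ proj₁) adm)))) (T≤B N)
    cases (yes PM) =
      let d , 0<d , 1≈h+d = <⇒∃+ (h<1 (prime⇒1< (P⇒prime PM)))
      in B * d ⁻¹ , λ N → *-cancelʳ-≤ 0<d (+-cancelʳ-≤ (h M * T M N) (begin
        T M N * d + h M * T M N        ≈⟨ solve 3 (λ t d h → t :* d :+ h :* t := (h :+ d) :* t) refl (T M N) d (h M) ⟩
        (h M + d) * T M N              ≈⟨ trans (*-congʳ (sym 1≈h+d)) (*-identityˡ _) ⟩
        T M N                          ≤⟨ ∑-convolution N (term-nonNegative M) 0≤w (step N) ⟩
        T (suc M) N + ∑ N w * T M N    ≤⟨ +-mono-≤ (T≤B N) (*-monoʳ-≤ (T-nonNegative M N) (∑-single N 0≤h)) ⟩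
        B + h M * T M N                ≈⟨ +-congʳ (trans (*-assoc _ _ _) (trans (*-congˡ (x⁻¹*x≈1 0<d)) (*-identityʳ B))) ⟨
        B * d ⁻¹ * d + h M * T M N     ∎))
      where
      pM : Prime M
      pM = P⇒prime PM
      0≤h : 0# ≤ h M
      0≤h = <⇒≤ (h-positive (prime⇒0< pM))
      w : ℕ → Carrier
      w p = when (p ≡ M) (h M)
      0≤w : ∀ p → 0# ≤ w p
      0≤w p = when-nonNegative λ _ → 0≤h
      step : ∀ N {n} → n ℕ.< N →
             term M n ≤ term (suc M) n + ∑ N (λ p → ∑ N (λ m → when (n ≡ p ℕ.* m) (w p * term M m)))
      step N {n} n<N = when-≤ (+-nonNegative (term-nonNegative (suc M) n) 0≤∑) λ adm → split adm em
        where
        0≤∑ : 0# ≤ ∑ N (λ p → ∑ N (λ m → when (n ≡ p ℕ.* m) (w p * term M m)))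
        0≤∑ = ∑-nonNegative N λ p → ∑-nonNegative N λ m → when-nonNegative λ _ →
                *-nonNegative (0≤w p) (term-nonNegative M m)
        split : Admissible M n → Dec (M ∣ n) →
                h n ≤ term (suc M) n + ∑ N (λ p → ∑ N (λ m → when (n ≡ p ℕ.* m) (w p * term M m)))
        split adm (yes M∣n) = ≤-trans (h-factor 0≤w adm n<N pM M∣n
          (≤-reflexive (sym (when-true ≡.refl)))) (y≤x+y _ (term-nonNegative (suc M) n))
        split adm (no M∤n) = ≤-trans (≤-reflexive (sym (when-true (admissible-suc (M∤n ∘ proj₂) adm))))
          (x≤x+y _ 0≤∑)

  T-bounded : Bounded (λ N → ∑ N P-weight) → Bounded (T 0)
  T-bounded bounded =
    let M , tail≤ = smallTails P-weight-nonNegative bounded (⁻¹-positive 0<2) in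
    descend M (T-bounded-by-tail M (≤-reflexive (x*x⁻¹≈1 0<2)) tail≤)
    where
    0<2 : 0# < 2#
    0<2 = fromℕ-positive {2} (s≤s z≤n)
    descend : ∀ M → Bounded (T M) → Bounded (T 0)
    descend zero    b = b
    descend (suc M) b = descend M (T-bounded-pred M b)

-- Divergence of the sum over P(S).

module Divergence (em : ExcludedMiddle 0ℓ) (R : CompleteOrderedField)
  (α : CompleteOrderedField.Carrier R)
  (1≤α : CompleteOrderedField._≤_ R (CompleteOrderedField.1# R) α)
  (S : Pred ℕ 0ℓ) (density : Classical.HasPolynomialDensity em R α S) where

  open OrderedField em R
  open RealPower em R
  open Exponent em R α 1≤α
  open Sum em R
  open Sieve em R α 1≤α (PrimeFactor S) proj₁
  open Classical em R

  s : ℕ → ℕ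
  s = proj₁ density

  s-positive : ∀ n → 0 ℕ.< s (suc n)
  s-positive n = proj₁ (proj₂ density) (suc n) (s≤s z≤n)

  s-increasing : ∀ n → s (suc n) ℕ.< s (suc (suc n))
  s-increasing n = proj₁ (proj₂ (proj₂ density)) (suc n) (suc (suc n)) (s≤s z≤n) ℕ.≤-refl

  s-admissible : ∀ n → Admissible 0 (s (suc n))
  s-admissible n = s-positive n , λ q pq q∣s →
    (pq , s (suc n) , Equivalence.from (proj₁ (proj₂ (proj₂ (proj₂ density))) _) (suc n , s≤s z≤n , ≡.refl) , q∣s) , z≤n

  -- Strict growth of `s` prevents double counting: as long as N ≤ s (n + 1), the value s (n + 1) is
  -- not yet among the indices of `T 0 N`.
  ∑h∘s≤T : ∀ n → ∃ λ N → N ℕ.≤ s (suc n) × ∑ n (λ i → h (s (suc i))) ≤ T 0 N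
  ∑h∘s≤T zero    = 0 , z≤n , ≤-refl
  ∑h∘s≤T (suc n) = let N , N≤s , ∑≤T = ∑h∘s≤T n in
    suc (s (suc n)) , s-increasing n , +-mono-≤
      (≤-trans ∑≤T (∑-monoˡ-≤ {m = N} (term-nonNegative 0) N≤s))
      (≤-reflexive (sym (when-true (s-admissible n))))

  weights-unbounded : ¬ Bounded (λ N → ∑ N P-weight)
  weights-unbounded bounded = harmonic-unbounded (B * D , λ n → begin
    harmonic n                              ≤⟨ ∑-mono-≤ n (λ {i} _ → inverse≤ i) ⟩
    ∑ n (λ i → h (s (suc i)) * D)           ≈⟨ ∑-*ʳ n D _ ⟩
    ∑ n (λ i → h (s (suc i))) * D           ≤⟨ *-monoʳ-≤ (<⇒≤ 0<D) (≤-trans (proj₂ (proj₂ (∑h∘s≤T n))) (T≤B (proj₁ (∑h∘s≤T n)))) ⟩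
    B * D                                   ∎)
    where
    C = proj₁ (proj₂ (proj₂ (proj₂ (proj₂ density))))
    s≤Cnᵅ = proj₂ (proj₂ (proj₂ (proj₂ (proj₂ (proj₂ density)))))
    B = proj₁ (T-bounded bounded)
    T≤B = proj₂ (T-bounded bounded)
    D = proj₁ (h-lower C)
    0<D = proj₁ (proj₂ (h-lower C))
    inverse≤ : ∀ i → fromℕ (suc i) ⁻¹ ≤ h (s (suc i)) * D
    inverse≤ i = *-cancelˡ-≤ 0<i (begin
      fromℕ (suc i) * fromℕ (suc i) ⁻¹     ≈⟨ x*x⁻¹≈1 0<i ⟩
      1#                                   ≤⟨ proj₂ (proj₂ (h-lower C)) (s-positive i) 0<1+i (s≤Cnᵅ (suc i) 0<1+i) ⟩
      h (s (suc i)) * fromℕ (suc i) * D    ≈⟨ solve 3 (λ a b c → a :* b :* c := b :* (a :* c)) refl _ _ _ ⟩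
      fromℕ (suc i) * (h (s (suc i)) * D)  ∎)
      where
      0<1+i : 0 ℕ.< suc i
      0<1+i = s≤s z≤n
      0<i : 0# < fromℕ (suc i)
      0<i = fromℕ-positive 0<1+i

  reciprocals-diverge : TendsTo∞ (λ n → sumOver (primeFactorsUpTo S n) h)
  reciprocals-diverge c =
    let m , c≤ = unbounded⇒tendsTo∞ (∑-monoˡ-≤ P-weight-nonNegative) weights-unbounded c
    in m , λ n m≤n → begin
      -- The list of primes includes n itself, whereas `∑` stops before its bound; hence the range
      -- `suc n`.
      c                                  ≤⟨ c≤ (suc n) (ℕ.m≤n⇒m≤1+n m≤n) ⟩
      ∑ (suc n) P-weight                 ≈⟨ sumOver-filter (PrimeFactor S) (suc n) h ⟨
      sumOver (primeFactorsUpTo S n) h   ∎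

  -- The counting function and the interchange of summation.

  v : ℕ → Carrier
  v n = (fromℕ n ^ᴿ (1# + β)) ⁻¹

  v-positive : ∀ n → 0# < v (suc n)
  v-positive n = ⁻¹-positive (^ᴿ-positive (1≤fromℕ {suc n} (s≤s z≤n)) _)

  ratio≈∑ : ∀ n → ratio α S n ≈ ∑ (suc n) (λ p → when (PrimeFactor S p) 1#) * v n
  ratio≈∑ n = *-congʳ (trans (fromℕ-length (primeFactorsUpTo S n)) (sumOver-filter (PrimeFactor S) (suc n) (λ _ → 1#)))

  ratio-nonNegative : ∀ n → 0# ≤ ratio α S (suc n)
  ratio-nonNegative n = *-nonNegative (fromℕ-nonNegative (π S (suc n))) (<⇒≤ (v-positive n))

  -- The interchange requires a range `L` of primes that does not depend on n; primes beyond suc n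
  -- contribute nothing.
  ratio-lower : ∀ L n → ∑ L (λ p → when (PrimeFactor S p × p ℕ.≤ suc n) (v (suc n))) ≤ ratio α S (suc n)
  ratio-lower L n = begin
    ∑ L f               ≤⟨ ∑-truncate (suc (suc n)) L 0≤f (λ n<p → ≤-reflexive (when-false (ℕ.<⇒≱ n<p ∘ proj₂))) ⟩
    ∑ (suc (suc n)) f   ≤⟨ ∑-mono-≤ (suc (suc n)) (λ {p} _ → when-≤ (0≤g p) λ (Pp , _) → ≤-reflexive (begin-equality
      v (suc n)                                 ≈⟨ *-identityˡ _ ⟨
      1# * v (suc n)                            ≈⟨ *-congʳ (when-true Pp) ⟨
      when (PrimeFactor S p) 1# * v (suc n)     ∎)) ⟩
    ∑ (suc (suc n)) (λ p → when (PrimeFactor S p) 1# * v (suc n)) ≈⟨ ∑-*ʳ (suc (suc n)) (v (suc n)) _ ⟩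
    ∑ (suc (suc n)) (λ p → when (PrimeFactor S p) 1#) * v (suc n) ≈⟨ ratio≈∑ (suc n) ⟨
    ratio α S (suc n)   ∎
    where
    f : ℕ → Carrier
    f p = when (PrimeFactor S p × p ℕ.≤ suc n) (v (suc n))
    0≤f : ∀ p → 0# ≤ f p
    0≤f p = when-nonNegative λ _ → <⇒≤ (v-positive n)
    0≤g : ∀ p → 0# ≤ when (PrimeFactor S p) 1# * v (suc n)
    0≤g p = *-nonNegative (when-nonNegative λ _ → 0≤1) (<⇒≤ (v-positive n))

  -- The p values n = p, …, 2p - 1 contribute at least h p / (16 p) each.
  prime-contribution : ∀ {p} M → PrimeFactor S p → p ℕ.+ p ℕ.≤ M →
    h p ≤ 16# * ∑ M (λ n → when (PrimeFactor S p × p ℕ.≤ suc n) (v (suc n)))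
  prime-contribution {zero}      M Pp _ = contradiction (prime⇒0< (proj₁ Pp)) λ ()
  prime-contribution {p@(suc q)} M Pp p+p≤M = *-cancelˡ-≤ 0<p (begin
    fromℕ p * h p
      ≈⟨ ∑-const p (h p) ⟨
    ∑ p (λ _ → h p)
      ≤⟨ ∑-mono-≤ p each ⟩
    ∑ p (λ i → 16# * fromℕ p * f (q ℕ.+ i))
      ≈⟨ ∑-*ˡ p (16# * fromℕ p) _ ⟩
    16# * fromℕ p * ∑ p (λ i → f (q ℕ.+ i))
      ≤⟨ *-monoˡ-≤ (*-nonNegative 16#-nonNegative (<⇒≤ 0<p)) (≤-trans (∑-tail-≤ q p 0≤f)
           (∑-monoˡ-≤ 0≤f (ℕ.≤-trans (ℕ.+-monoˡ-≤ p (ℕ.n≤1+n q)) p+p≤M))) ⟩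
    16# * fromℕ p * ∑ M f
      ≈⟨ solve 3 (λ a b c → a :* b :* c := b :* (a :* c)) refl _ _ _ ⟩
    fromℕ p * (16# * ∑ M f) ∎)
    where
    0<p : 0# < fromℕ p
    0<p = fromℕ-positive {p} (s≤s z≤n)
    f : ℕ → Carrier
    f n = when (PrimeFactor S p × p ℕ.≤ suc n) (v (suc n))
    0≤f : ∀ n → 0# ≤ f n
    0≤f n = when-nonNegative λ _ → <⇒≤ (v-positive n)
    -- Position `q + i` of `f` stands for the integer suc (q + i) = p + i, which is below 2 p.
    -- Multiplying by the power `G` removes the inverse in `v`.
    each : ∀ {i} → i ℕ.< p → h p ≤ 16# * fromℕ p * f (q ℕ.+ i)
    each {i} i<p = *-cancelˡ-≤ 0<G (begin
      G * h p                         ≤⟨ power*h≤16p (s≤s z≤n) (s≤s z≤n) n≤2p ⟩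
      16# * fromℕ p                   ≈⟨ *-identityʳ _ ⟨
      16# * fromℕ p * 1#              ≈⟨ *-congˡ (x*x⁻¹≈1 0<G) ⟨
      16# * fromℕ p * (G * v n)       ≈⟨ solve 3 (λ a b c → a :* (b :* c) := b :* (a :* c)) refl _ _ _ ⟩
      G * (16# * fromℕ p * v n)       ≈⟨ *-congˡ (*-congˡ (when-true (Pp , s≤s (ℕ.m≤m+n q i)))) ⟨
      G * (16# * fromℕ p * f (q ℕ.+ i)) ∎)
      where
      n : ℕ
      n = suc (q ℕ.+ i)
      G : Carrier
      G = fromℕ n ^ᴿ (1# + β)
      0<G : 0# < G
      0<G = ^ᴿ-positive (1≤fromℕ {n} (s≤s z≤n)) _
      n≤2p : n ℕ.≤ 2 ℕ.* p
      n≤2p = ℕ.≤-trans (ℕ.+-monoʳ-≤ p (ℕ.<⇒≤ i<p)) (ℕ.≤-reflexive (≡.cong (p ℕ.+_) (≡.sym (ℕ.+-identityʳ p))))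

  -- For p < L the window p ≤ n < 2 p lies within the first L + L terms, so one range serves all
  -- these primes.
  ∑weights≤∑ratio : ∀ L → ∑ L P-weight ≤ 16# * ∑ (L ℕ.+ L) (λ n → ratio α S (suc n))
  ∑weights≤∑ratio L = begin
    ∑ L P-weight
      ≤⟨ ∑-mono-≤ L (λ {p} p<L → when-≤ (*-nonNegative 16#-nonNegative (∑-nonNegative (L ℕ.+ L) (0≤f p)))
           λ Pp → prime-contribution (L ℕ.+ L) Pp (ℕ.+-mono-≤ (ℕ.<⇒≤ p<L) (ℕ.<⇒≤ p<L))) ⟩
    ∑ L (λ p → 16# * ∑ (L ℕ.+ L) (f p))
      ≈⟨ trans (∑-*ˡ L 16# _) (*-congˡ (∑-swap L (L ℕ.+ L) f)) ⟩
    16# * ∑ (L ℕ.+ L) (λ n → ∑ L (λ p → f p n))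
      ≤⟨ *-monoˡ-≤ 16#-nonNegative (∑-mono-≤ (L ℕ.+ L) λ {n} _ → ratio-lower L n) ⟩
    16# * ∑ (L ℕ.+ L) (λ n → ratio α S (suc n)) ∎
    where
    f : ℕ → ℕ → Carrier
    f p n = when (PrimeFactor S p × p ℕ.≤ suc n) (v (suc n))
    0≤f : ∀ p n → 0# ≤ f p n
    0≤f p n = when-nonNegative λ _ → <⇒≤ (v-positive n)

  ratios-unbounded : ¬ Bounded (λ N → ∑ N (λ n → ratio α S (suc n)))
  ratios-unbounded (B , ∑≤B) = weights-unbounded (16# * B , λ L →
    ≤-trans (∑weights≤∑ratio L) (*-monoˡ-≤ 16#-nonNegative (∑≤B (L ℕ.+ L))))

  ratios-diverge : TendsTo∞ (partialSum (ratio α S))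
  ratios-diverge c =
    let m , c≤ = unbounded⇒tendsTo∞ (∑-monoˡ-≤ ratio-nonNegative) ratios-unbounded c
    in m , λ n m≤n → ≤-trans (c≤ n m≤n) (≤-reflexive (sym (partialSum≈∑ (ratio α S) n)))

  -- Comparison with a convergent series.

  converges⇒bounded : ∀ {a} → (∀ i → 0# ≤ a (suc i)) → Converges (partialSum a) →
                      Bounded (λ n → ∑ n (a ∘ suc))
  converges⇒bounded {a} 0≤a (l , limit) =
    let m , near = limit 1# 0<1 in
    l + 1# , λ n → begin
      -- Lengthening the sum by `m` brings it into the range controlled by the limit, so that small
      -- n need no separate treatment.
      ∑ n (a ∘ suc)               ≤⟨ ∑-monoˡ-≤ 0≤a (ℕ.m≤n+m n m) ⟩
      ∑ (m ℕ.+ n) (a ∘ suc)       ≈⟨ partialSum≈∑ a (m ℕ.+ n) ⟨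
      partialSum a (m ℕ.+ n)      ≤⟨ proj₁ (near (m ℕ.+ n) (ℕ.m≤m+n m n)) ⟩
      l + 1#                      ∎

  -- If the ratios stayed below `a` beyond `m`, their partial sums would be bounded by the sum of
  -- the first `m` ratios plus a bound for the sums of `a`.
  ratio-infinitelyOften : (a : ℕ → Carrier) → (∀ n → 1 ℕ.≤ n → 0# < a n) →
    Converges (partialSum a) → Infinite (λ n → 1 ℕ.≤ n × a n ≤ ratio α S n)
  ratio-infinitelyOften a 0<a conv m = decide em
    where
    0≤a : ∀ i → 0# ≤ a (suc i)
    0≤a i = <⇒≤ (0<a (suc i) (s≤s z≤n))
    r : ℕ → Carrier
    r n = ratio α S (suc n)
    B = proj₁ (converges⇒bounded 0≤a conv)
    ∑a≤B = proj₂ (converges⇒bounded 0≤a conv)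
    decide : Dec (∃ λ n → m ℕ.≤ n × 1 ℕ.≤ n × a n ≤ ratio α S n) →
             ∃ λ n → m ℕ.≤ n × 1 ℕ.≤ n × a n ≤ ratio α S n
    decide (yes p) = p
    decide (no ∄n) = contradiction (∑ m r + B , λ n → begin
      ∑ n r                                           ≤⟨ ∑-monoˡ-≤ ratio-nonNegative (ℕ.m≤n+m n m) ⟩
      ∑ (m ℕ.+ n) r                                   ≈⟨ ∑-split m n r ⟩
      ∑ m r + ∑ n (λ i → r (m ℕ.+ i))                 ≤⟨ +-monoʳ-≤ _ (∑-mono-≤ n λ {i} _ → <⇒≤ (≰⇒> λ a≤r →
        ∄n (suc (m ℕ.+ i) , ℕ.m≤n⇒m≤1+n (ℕ.m≤m+n m i) , s≤s z≤n , a≤r))) ⟩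
      ∑ m r + ∑ n (λ i → a (suc (m ℕ.+ i)))           ≤⟨ +-monoʳ-≤ _ (≤-trans (∑-tail-≤ m n 0≤a) (∑a≤B (m ℕ.+ n))) ⟩
      ∑ m r + B                                       ∎) ratios-unbounded

theorem1 :
  (em : ExcludedMiddle 0ℓ) (R : CompleteOrderedField) →
  let open CompleteOrderedField R
      open Classical em R in
  (α : Carrier) → 1# ≤ α →
  (S : Pred ℕ 0ℓ) → (∀ k → S k → 0 ℕ.< k) → Infinite S →
  HasPolynomialDensity α S →
  TendsTo∞ (λ n → sumOver (primeFactorsUpTo S n) (λ p → fromℕ p ^ᴿ (- (α ⁻¹)))) ×
  TendsTo∞ (partialSum (ratio α S)) ×
  ((a : ℕ → Carrier) → (∀ n → 1 ℕ.≤ n → 0# < a n) →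
    Converges (partialSum a) →
    Infinite (λ n → 1 ℕ.≤ n × a n ≤ ratio α S n))
theorem1 em R α 1≤α S _ _ density = reciprocals-diverge , ratios-diverge , ratio-infinitelyOften
  where open Divergence em R α 1≤α S density
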